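{- Let $G=(V,A,s)$ be a flow graph. Then for every choice of depth-first spanning tree, bottom-up numbering, and order of arc selections, Algorithm GD (Version 1) terminates on $G$ and, for every vertex $w\ne s$, assigns to $d(w)$ the immediate dominator of $w$ in $G$.
   Context: A flow graph $G=(V,A,s)$ is a finite directed graph with start vertex $s$ from which every vertex is reachable; assume $n=|V|>1$, no arcs enter $s$, and $G$ has no multiple arcs and no loop arcs. A vertex $x$ dominates $y$ if every path from $s$ to $y$ contains $x$; the immediate dominator of $y\neq s$ is the unique dominator $d(y)\ne y$ of $y$ dominated by all dominators of $y$ other than $y$. A depth-first spanning tree is the tree of parent pointers produced by a depth-first search of $G$ from $s$ (recursively visiting, from the current vertex, each unvisited head of an outgoing arc). For the current spanning tree with parent function $p$, an arc $(x,w)$ is a tree arc if $x=p(w)$, forward if $x$ is a proper ancestor of $p(w)$, back if $x$ is a proper descendant of $w$, loop if $x=w$. Contracting $v$ into $p(v)$ replaces every arc end equal to $v$ by $p(v)$, deletes $v$, and makes the former children of $v$ children of $p(v)$; each arc so produced is marked iff the arc it replaces was marked. For $u$ a proper ancestor of $v$, $\mathit{transform}(u,v)$ is: Step 0: for each arc from $v$ to a proper descendant $w\notin\{v,p(v)\}$ of $u$, add a new unmarked arc $(p(u),w)$; Step 1: contract $v$ into $p(v)$. Algorithm GD (Version 1): choose a depth-first spanning tree $T$ of $G$ with parent function $p$; number vertices $1,\dots,n$ with $x<p(x)$ for $x\ne s$ and identify vertices with numbers; unmark all arcs; set $\mathit{same}(x)=\{x\}$ for all $x$. For $u=1,\dots,n$: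 (first loop) while some tree or forward arc $(u,v)$ is unmarked: mark it; if all arcs into $v$ are marked, then (if $u=p(v)$ set $d(w)\leftarrow u$ for all $w\in\mathit{same}(v)$, else $\mathit{same}(p(v))\leftarrow\mathit{same}(p(v))\cup\mathit{same}(v)$) and contract $v$ into $p(v)$; (second loop) while there exists an unmarked back or loop arc $(v,u)$: if $v=u$ mark $(v,u)$, else set $\mathit{same}(u)\leftarrow\mathit{same}(u)\cup\mathit{same}(v)$ and perform $\mathit{transform}(u,v)$. All notions refer to the current graph and current tree. -}

module Defs where

open import Data.Nat using (ℕ; zero; suc; _<_)
open import Data.Fin using (Fin; fromℕ<; _≟_)
import Data.Fin as F
open import Data.Fin.Permutation using (Permutation′; _⟨$⟩ʳ_; _⟨$⟩ˡ_)
open import Data.Bool using (Bool; true; false)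
open import Data.Maybe using (Maybe; just; nothing)
open import Data.List using (List; []; _∷_; _++_; map)
open import Data.List.Membership.Propositional using (_∈_)
open import Data.List.Relation.Unary.All using (All)
open import Data.List.Relation.Unary.Unique.Propositional using (Unique)
open import Data.Product using (Σ; ∃; _×_; _,_)
open import Data.Sum using (_⊎_)
open import Data.Empty using (⊥)
open import Relation.Nullary using (¬_; yes; no)
open import Relation.Binary.PropositionalEquality using (_≡_; _≢_)
open import Relation.Binary.Construct.Closure.ReflexiveTransitive using (Star)
open import Induction.WellFounded using (Acc)
import Data.Product

record FlowGraph (n : ℕ) : Set where
  field
    arcs      : List (Fin n × Fin n)
    start     : Fin n
    n>1       : 1 < n
    noMulti   : Unique arcs
    noLoop    : All (λ { (x , y) → x ≢ y }) arcs
    noInStart : All (λ { (x , y) → y ≢ start }) arcs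
    reachable : ∀ v → Star (λ x y → (x , y) ∈ arcs) start v
open FlowGraph public

data Walk {n} (A : List (Fin n × Fin n)) : Fin n → Fin n → Set where
  here : ∀ {x} → Walk A x x
  step : ∀ {x z y} → (x , z) ∈ A → Walk A z y → Walk A x y

data Visits {n} {A : List (Fin n × Fin n)} (v : Fin n) :
            ∀ {x y} → Walk A x y → Set where
  at-here : Visits v (here {x = v})
  at-step : ∀ {z y} {e : (v , z) ∈ A} {w : Walk A z y} → Visits v (step e w)
  later   : ∀ {x z y} {e : (x , z) ∈ A} {w : Walk A z y} →
            Visits v w → Visits v (step e w)

Dominates : ∀ {n} → FlowGraph n → Fin n → Fin n → Set
Dominates G x y = (w : Walk (arcs G) (start G) y) → Visits x w

IsIdom : ∀ {n} → FlowGraph n → Fin n → Fin n → Set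
IsIdom G x y =
  x ≢ y × Dominates G x y ×
  (∀ z → Dominates G z y → z ≢ y → Dominates G z x)

Parent : ℕ → Set
Parent n = Fin n → Maybe (Fin n)

update : ∀ {n} {B : Set} → Fin n → B → (Fin n → B) → Fin n → B
update v b f x with x ≟ v
... | yes _ = b
... | no  _ = f x

record DFSState (n : ℕ) : Set where
  constructor dfs
  field
    stack  : List (Fin n)
    parent : Parent n

Visited : ∀ {n} → FlowGraph n → Parent n → Fin n → Set
Visited G p w = w ≡ start G ⊎ ∃ λ x → p w ≡ just x

data DFSStep {n} (G : FlowGraph n) : DFSState n → DFSState n → Set where
  visit : ∀ {v st p w} → (v , w) ∈ arcs G → ¬ Visited G p w →
          DFSStep G (dfs (v ∷ st) p) (dfs (w ∷ v ∷ st) (update w (just v) p))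
  retreat : ∀ {v st p} → (∀ w → (v , w) ∈ arcs G → Visited G p w) →
          DFSStep G (dfs (v ∷ st) p) (dfs st p)

IsDFSTree : ∀ {n} → (G : FlowGraph n) → Parent n → Set
IsDFSTree G p =
  Star (DFSStep G) (dfs (start G ∷ []) (λ _ → nothing)) (dfs [] p)

-- bottom-up numbering: num x < num p(x)  (numbers 0..n-1 instead of 1..n)
IsNumbering : ∀ {n} → Parent n → Permutation′ n → Set
IsNumbering p num = ∀ x y → p x ≡ just y → (num ⟨$⟩ʳ x) F.< (num ⟨$⟩ʳ y)

-- an arc of the current (multi)graph: tail, head, marked?
Arc : ℕ → Set
Arc n = Fin n × Fin n × Bool

data PAnc {n} (p : Parent n) (x : Fin n) : Fin n → Set where
  par  : ∀ {y} → p y ≡ just x → PAnc p x y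
  up   : ∀ {y z} → p y ≡ just z → PAnc p x z → PAnc p x y

TreeArc : ∀ {n} → Parent n → Fin n → Fin n → Set
TreeArc p x w = p w ≡ just x

ForwardArc : ∀ {n} → Parent n → Fin n → Fin n → Set
ForwardArc p x w = ∃ λ z → p w ≡ just z × PAnc p x z

BackArc : ∀ {n} → Parent n → Fin n → Fin n → Set
BackArc p x w = PAnc p w x

LoopArc : ∀ {n} → Fin n → Fin n → Set
LoopArc x w = x ≡ w

AllMarkedInto : ∀ {n} → Fin n → List (Arc n) → Set
AllMarkedInto v as = ∀ x b → (x , v , b) ∈ as → b ≡ true

rename : ∀ {n} → Fin n → Fin n → Fin n → Fin n
rename v pv y with y ≟ v
... | yes _ = pv
... | no  _ = y

contractArcs : ∀ {n} → Fin n → Fin n → List (Arc n) → List (Arc n)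
contractArcs v pv = map (λ { (x , w , b) → (rename v pv x , rename v pv w , b) })

redirect : ∀ {n} → Fin n → Fin n → Maybe (Fin n) → Maybe (Fin n)
redirect v pv (just y) = just (rename v pv y)
redirect v pv nothing  = nothing

contractPar : ∀ {n} → Fin n → Fin n → Parent n → Parent n
contractPar v pv p x = redirect v pv (p x)

assignAll : ∀ {n} → List (Fin n) → Fin n → (Fin n → Maybe (Fin n)) →
            Fin n → Maybe (Fin n)
assignAll []       u d = d
assignAll (w ∷ ws) u d = update w (just u) (assignAll ws u d)

-- Step 0 of transform(u,v): the new arcs (p(u), w), one for every arc
-- (v, w) with w a proper descendant of u, w ≠ v, w ≠ p(v).
-- (When u has no parent, i.e. u = s, no arcs are added.)
Step0Cond : ∀ {n} → Parent n → Fin n → Fin n → Arc n → Set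
Step0Cond p u v (x , w , b) = x ≡ v × PAnc p u w × w ≢ v × p v ≢ just w

data Step0 {n} (p : Parent n) (u v : Fin n) : List (Arc n) → List (Arc n) → Set where
  []   : Step0 p u v [] []
  keep : ∀ {a as ns pu} → Step0Cond p u v a → p u ≡ just pu →
         Step0 p u v as ns →
         Step0 p u v (a ∷ as) ((pu , Data.Product.proj₁ (Data.Product.proj₂ a) , false) ∷ ns)
  skip : ∀ {a as ns} → ¬ (Step0Cond p u v a × ∃ λ pu → p u ≡ just pu) →
         Step0 p u v as ns → Step0 p u v (a ∷ as) ns

data Phase : Set where
  loop1 : ℕ → Phase
  loop2 : ℕ → Phase

record GDState (n : ℕ) : Set where
  constructor st
  field
    garcs : List (Arc n)
    gpar  : Parent n
    same  : Fin n → List (Fin n)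
    dom   : Fin n → Maybe (Fin n)
    phase : Phase
open GDState public

vertexAt : ∀ {n} → Permutation′ n → (i : ℕ) → i < n → Fin n
vertexAt num i i<n = num ⟨$⟩ˡ fromℕ< i<n

data GDStep {n} (num : Permutation′ n) : GDState n → GDState n → Set where
  mark1 : ∀ {i i<n xs ys v p sm d} → let u = vertexAt num i i<n
                                         as' = xs ++ (u , v , true) ∷ ys in
          (TreeArc p u v ⊎ ForwardArc p u v) →
          ¬ AllMarkedInto v as' →
          GDStep num (st (xs ++ (u , v , false) ∷ ys) p sm d (loop1 i))
                     (st as' p sm d (loop1 i))
  mark1-idom : ∀ {i i<n xs ys v p sm d} → let u = vertexAt num i i<n
                                              as' = xs ++ (u , v , true) ∷ ys in
          (TreeArc p u v ⊎ ForwardArc p u v) →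
          AllMarkedInto v as' → p v ≡ just u →
          GDStep num (st (xs ++ (u , v , false) ∷ ys) p sm d (loop1 i))
                     (st (contractArcs v u as') (contractPar v u p) sm
                         (assignAll (sm v) u d) (loop1 i))
  mark1-same : ∀ {i i<n xs ys v pv p sm d} → let u = vertexAt num i i<n
                                                 as' = xs ++ (u , v , true) ∷ ys in
          (TreeArc p u v ⊎ ForwardArc p u v) →
          AllMarkedInto v as' → p v ≡ just pv → pv ≢ u →
          GDStep num (st (xs ++ (u , v , false) ∷ ys) p sm d (loop1 i))
                     (st (contractArcs v pv as') (contractPar v pv p)
                         (update pv (sm pv ++ sm v) sm) d (loop1 i))
  exit1 : ∀ {i i<n as p sm d} → let u = vertexAt num i i<n in
          (∀ v → (u , v , false) ∈ as → ¬ (TreeArc p u v ⊎ ForwardArc p u v)) →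
          GDStep num (st as p sm d (loop1 i)) (st as p sm d (loop2 i))
  mark2 : ∀ {i i<n xs ys p sm d} → let u = vertexAt num i i<n in
          GDStep num (st (xs ++ (u , u , false) ∷ ys) p sm d (loop2 i))
                     (st (xs ++ (u , u , true) ∷ ys) p sm d (loop2 i))
  transform : ∀ {i i<n as v pv ns p sm d} → let u = vertexAt num i i<n in
          (v , u , false) ∈ as → BackArc p v u → p v ≡ just pv →
          Step0 p u v as ns →
          GDStep num (st as p sm d (loop2 i))
                     (st (contractArcs v pv (as ++ ns)) (contractPar v pv p)
                         (update u (sm u ++ sm v) sm) d (loop2 i))
  exit2 : ∀ {i i<n as p sm d} → let u = vertexAt num i i<n in
          (∀ v → (v , u , false) ∈ as → ¬ (BackArc p v u ⊎ LoopArc v u)) →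
          GDStep num (st as p sm d (loop2 i)) (st as p sm d (loop1 (suc i)))

initGD : ∀ {n} → FlowGraph n → Parent n → GDState n
initGD G p = st (map (λ { (x , y) → (x , y , false) }) (arcs G)) p
                (λ x → x ∷ []) (λ _ → nothing) (loop1 0)

Terminates : ∀ {n} → Permutation′ n → GDState n → Set
Terminates num σ = Acc (λ τ σ → GDStep num σ τ) σ

{-# OPTIONS --safe #-}

-- Call a vertex processed once the first loop for it has ended. The invariant is that a
-- strictly dominates w ∈ same(x) in G if and only if a is unprocessed and strictly
-- dominates x in the current graph. A contraction of v into p(v) moves only arcs at
-- processed vertices, and every walk into v that avoids an unprocessed a can be rerouted
-- to p(v) along tree arcs below u, so dominance by unprocessed vertices does not change;
-- the same rerouting shows that the arcs added by transform create no new such walks. That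
-- u dominates nothing when its first loop ends follows from the post-order of the depth-
-- first search: every surviving vertex has an unmarked incoming arc, and such an arc is
-- neither a back nor a loop arc when its head is processed. The algorithm terminates since
-- each step advances the phase, contracts a vertex, or marks an arc.
module Submission where

open import Defs
open import Data.Bool using (Bool; true; false)
open import Data.Empty using (⊥; ⊥-elim)
open import Data.Fin using (Fin; toℕ; _≟_)
open import Data.Fin.Permutation using (Permutation′; _⟨$⟩ʳ_; _⟨$⟩ˡ_; inverseˡ; inverseʳ)
open import Data.Fin.Properties using (toℕ-fromℕ<; toℕ-injective; toℕ<n)
open import Data.List using (List; []; _∷_; _++_; map; filter; length; allFin)
open import Data.List.Membership.Propositional using (_∈_; _∉_)
open import Data.List.Membership.Propositional.Properties
  using (∈-map⁻; ∈-++⁺ˡ; ∈-++⁺ʳ; ∈-++⁻; ∈-filter⁺; ∈-filter⁻; ∈-∃++; ∈-allFin)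
open import Data.List.Properties using (filter-notAll)
open import Data.List.Relation.Unary.All as All using ([]; _∷_)
import Data.List.Relation.Unary.All.Properties as All
open import Data.List.Relation.Unary.AllPairs using ([]; _∷_)
open import Data.List.Relation.Unary.Any as Any using (here; there)
open import Data.List.Relation.Unary.Unique.Propositional using (Unique)
open import Data.Maybe using (Maybe; just; nothing)
open import Data.Maybe.Properties using (just-injective)
open import Data.Nat using (ℕ; suc; _+_; _∸_; _<_; _≤_; z≤n; s≤s)
open import Data.Nat.Induction using (<-wellFounded)
open import Data.Nat.Properties
  using (≤-refl; ≤-trans; ≤-reflexive; <-irrefl; <-trans; <-≤-trans; <⇒≤;
         m<n⇒m<1+n; m≤n⇒m<n∨m≡n; n<1+n; n≤1+n; ∸-monoʳ-<; +-monoˡ-<; +-monoʳ-<)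
open import Data.Product using (∃; ∃₂; _×_; _,_; proj₁; proj₂)
open import Data.Product.Relation.Binary.Lex.Strict using (×-Lex; ×-wellFounded)
open import Data.Sum using (_⊎_; inj₁; inj₂)
open import Function using (_∘_; case_of_)
open import Induction.WellFounded using (Acc; acc; WellFounded)
open import Relation.Binary.Construct.Closure.ReflexiveTransitive using (Star; ε; _◅_)
open import Relation.Binary.PropositionalEquality using (_≡_; _≢_; refl; sym; trans; cong; subst)
open import Relation.Nullary using (¬_; Dec; yes; no; ¬?)
open import Relation.Nullary.Decidable using (decidable-stable; map′; _⊎-dec_)

-- Walks that avoid a vertex, and dominance.

module _ {n : ℕ} where

  open import Data.List.Membership.DecPropositional (_≟_ {n}) using (_∈?_) public

  Rel : Set₁
  Rel = Fin n → Fin n → Set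

  -- The arc relation is arbitrary, so the same notion serves for the input graph and for the marked
  -- multigraph of the algorithm; its negation is dominance of `x` by `a`. Walks grow at the far end
  -- because the rerouting arguments inspect the last arc.
  data Avoiding (E : Rel) (s a : Fin n) : Fin n → Set where
    source : s ≢ a → Avoiding E s a s
    extend : ∀ {t x} → Avoiding E s a t → E t x → x ≢ a → Avoiding E s a x

  avoiding-≢ : ∀ {E : Rel} {s a x} → Avoiding E s a x → x ≢ a
  avoiding-≢ (source s≢a)     = s≢a
  avoiding-≢ (extend _ _ x≢a) = x≢a

  ¬avoiding-source : ∀ {E : Rel} {s x} → ¬ Avoiding E s s x
  ¬avoiding-source (source s≢s)   = s≢s refl
  ¬avoiding-source (extend r _ _) = ¬avoiding-source r

  avoiding-map : ∀ {E E′ : Rel} {s a} (f : Fin n → Fin n) → f s ≡ s →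
    (∀ {t x} → E t x → E′ (f t) (f x)) →
    (∀ {x} → Avoiding E s a x → f x ≢ a) →
    ∀ {x} → Avoiding E s a x → Avoiding E′ s a (f x)
  avoiding-map f fs≡s h g (source s≢a) =
    subst (Avoiding _ _ _) (sym fs≡s) (source s≢a)
  avoiding-map f fs≡s h g r@(extend r′ e _) =
    extend (avoiding-map f fs≡s h g r′) (h e) (g r)

  -- An arc of `E′` need not be simulated by a path of `E` between the same ends: any walk that
  -- avoids `a` and reaches the head will do, given one that reaches the tail.
  avoiding-lift : ∀ {E E′ : Rel} {s a} →
    (∀ {t x} → E′ t x → Avoiding E s a t → x ≢ a → Avoiding E s a x) →
    ∀ {x} → Avoiding E′ s a x → Avoiding E s a x
  avoiding-lift h (source s≢a)     = source s≢a
  avoiding-lift h (extend r e x≢a) = h e (avoiding-lift h r) x≢a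

  avoiding-⊆ : ∀ {E E′ : Rel} {s a} → (∀ {t x} → E t x → E′ t x) →
    ∀ {x} → Avoiding E s a x → Avoiding E′ s a x
  avoiding-⊆ h = avoiding-lift λ e r x≢a → extend r (h e) x≢a

  StrictDom : Rel → Fin n → Fin n → Fin n → Set
  StrictDom E s a x = a ≢ x × ¬ Avoiding E s a x

  module _ {A : List (Fin n × Fin n)} where

    visits-first : ∀ {x y} (w : Walk A x y) → Visits x w
    visits-first here       = at-here
    visits-first (step _ _) = at-step

    visits-last : ∀ {x y} (w : Walk A x y) → Visits y w
    visits-last here       = at-here
    visits-last (step _ w) = later (visits-last w)

    visits? : ∀ a {x y} (w : Walk A x y) → Dec (Visits a w)
    visits? a (here {x}) = map′ (λ { refl → at-here }) (λ { at-here → refl }) (a ≟ x)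
    visits? a (step {x} _ w) =
      map′ (λ { (inj₁ refl) → at-step ; (inj₂ v) → later v })
           (λ { at-step → inj₁ refl ; (later v) → inj₂ v })
           ((a ≟ x) ⊎-dec visits? a w)

    private
      ArcOf : Rel
      ArcOf t x = (t , x) ∈ A

    avoiding⇒walk : ∀ {s a x y} → Avoiding ArcOf s a x →
      (w : Walk A x y) → ¬ Visits a w → ∃ λ (w′ : Walk A s y) → ¬ Visits a w′
    avoiding⇒walk (source _)     w a∉w = w , a∉w
    avoiding⇒walk (extend r e _) w a∉w = avoiding⇒walk r (step e w)
      λ { at-step → avoiding-≢ r refl ; (later v) → a∉w v }

    walk⇒avoiding : ∀ {s a x y} → Avoiding ArcOf s a x →
      (w : Walk A x y) → ¬ Visits a w → Avoiding ArcOf s a y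
    walk⇒avoiding r here       a∉w = r
    walk⇒avoiding r (step e w) a∉w =
      walk⇒avoiding (extend r e λ { refl → a∉w (later (visits-first w)) }) w (a∉w ∘ later)

  FlowArc : FlowGraph n → Rel
  FlowArc G t x = (t , x) ∈ arcs G

  -- Visiting a vertex is decidable along a given walk, so it is enough to refute that the walk
  -- misses `a`.
  ¬avoiding⇒dominates : ∀ (G : FlowGraph n) {a x} →
    ¬ Avoiding (FlowArc G) (start G) a x → Dominates G a x
  ¬avoiding⇒dominates G {a} ¬r w = decidable-stable (visits? a w) λ a∉w →
    ¬r (walk⇒avoiding (source λ { refl → a∉w (visits-first w) }) w a∉w)

  dominates⇒¬avoiding : ∀ (G : FlowGraph n) {a x} →
    Dominates G a x → ¬ Avoiding (FlowArc G) (start G) a x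
  dominates⇒¬avoiding G a-dom r
    with w , a∉w ← avoiding⇒walk r here (λ { at-here → avoiding-≢ r refl }) = a∉w (a-dom w)

  update-≡ : ∀ {B : Set} v (f : Fin n → B) x {b} → x ≡ v → update v b f x ≡ b
  update-≡ v f x x≡v with x ≟ v
  ... | yes _   = refl
  ... | no  x≢v = ⊥-elim (x≢v x≡v)

  update-≢ : ∀ {B : Set} v (f : Fin n → B) x {b} → x ≢ v → update v b f x ≡ f x
  update-≢ v f x x≢v with x ≟ v
  ... | yes x≡v = ⊥-elim (x≢v x≡v)
  ... | no  _   = refl

  -- Ancestors under a parent function.

  AncEq : Parent n → Fin n → Fin n → Set
  AncEq p a x = a ≡ x ⊎ PAnc p a x

  just-unique : ∀ (p : Parent n) {x y z} → p x ≡ just y → p x ≡ just z → y ≡ z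
  just-unique p py pz = just-injective (trans (sym py) pz)

  ancestor-via-parent : ∀ (p : Parent n) {a x y} → p x ≡ just y → PAnc p a x → AncEq p a y
  ancestor-via-parent p py (par pa) = inj₁ (just-unique p pa py)
  ancestor-via-parent p {a} py (up pz q) = inj₂ (subst (PAnc p a) (just-unique p pz py) q)

  has-parent : ∀ {p : Parent n} {a x} → PAnc p a x → ∃ λ y → p x ≡ just y
  has-parent (par e)  = _ , e
  has-parent (up e _) = _ , e

  panc-trans-parent : ∀ {p : Parent n} {v y x} → p v ≡ just y → PAnc p v x → PAnc p y x
  panc-trans-parent e (par e′)  = up e′ (par e)
  panc-trans-parent e (up e′ q) = up e′ (panc-trans-parent e q)

  panc-mono : ∀ {p q : Parent n} → (∀ {x y} → p x ≡ just y → q x ≡ just y) →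
    ∀ {a x} → PAnc p a x → PAnc q a x
  panc-mono h (par e)  = par (h e)
  panc-mono h (up e r) = up (h e) (panc-mono h r)

  ancEq-mono : ∀ {p q : Parent n} → (∀ {x y} → p x ≡ just y → q x ≡ just y) →
    ∀ {a x} → AncEq p a x → AncEq q a x
  ancEq-mono h (inj₁ e) = inj₁ e
  ancEq-mono h (inj₂ r) = inj₂ (panc-mono h r)

-- Depth-first search and its post-order.

module DepthFirst {n} (G : FlowGraph n) where

  -- The search stack is the tree path from the current vertex up to the root.
  data Chain (p : Parent n) : List (Fin n) → Set where
    empty  : Chain p []
    bottom : ∀ {x} → p x ≡ nothing → Chain p (x ∷ [])
    link   : ∀ {x y ys} → p x ≡ just y → Chain p (y ∷ ys) → Chain p (x ∷ y ∷ ys)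

  chain-mono : ∀ {p q xs} → (∀ {x} → x ∈ xs → q x ≡ p x) → Chain p xs → Chain q xs
  chain-mono h empty      = empty
  chain-mono h (bottom e) = bottom (trans (h (here refl)) e)
  chain-mono h (link e c) = link (trans (h (here refl)) e) (chain-mono (h ∘ there) c)

  chain-tail : ∀ {p v vs} → Chain p (v ∷ vs) → Chain p vs
  chain-tail (bottom _) = empty
  chain-tail (link _ c) = c

  chain-parent : ∀ {p v vs x y} → Chain p (v ∷ vs) → x ∈ v ∷ vs → p x ≡ just y → y ∈ vs
  chain-parent (bottom e) (here refl) e′ with () ← trans (sym e) e′
  chain-parent {p} (link e c) (here refl) e′ = here (just-unique p e′ e)
  chain-parent (link e c) (there x∈) e′ = there (chain-parent c x∈ e′)

  chain-ancestor : ∀ {p v vs y} → Chain p (v ∷ vs) → y ∈ v ∷ vs → AncEq p y v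
  chain-ancestor c (here e) = inj₁ e
  chain-ancestor (link e c) (there y∈) with chain-ancestor c y∈
  ... | inj₁ refl = inj₂ (par e)
  ... | inj₂ q    = inj₂ (up e q)

  Finished : Parent n → List (Fin n) → Fin n → Set
  Finished p stack x = Visited G p x × x ∉ stack

  -- post numbers vertices in the order in which the search retreats from them
  -- and is meaningless on unfinished vertices; clock is the next number.
  record Search (p : Parent n) (stack : List (Fin n)) (post : Fin n → ℕ) (clock : ℕ) : Set where
    Below : Fin n → Fin n → Set
    Below y x = Finished p stack y × post y < post x

    field
      start-rootless : p (start G) ≡ nothing
      parent-arc     : ∀ {x y} → p x ≡ just y → (y , x) ∈ arcs G
      parent-visited : ∀ {x y} → p x ≡ just y → Visited G p y
      chain          : Chain p stack
      unique         : Unique stack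
      stack-visited  : ∀ {x} → x ∈ stack → Visited G p x
      post<clock     : ∀ {x} → Finished p stack x → post x < clock
      children-first : ∀ {x y} → p x ≡ just y → Finished p stack y → Below x y
      heads-visited  : ∀ {x y} → Finished p stack x → (x , y) ∈ arcs G → Visited G p y
      heads          : ∀ {x y} → Finished p stack x → (x , y) ∈ arcs G →
                       AncEq p y x ⊎ Below y x
      parents        : ∀ {x y z} → Finished p stack x → Below z x → p z ≡ just y →
                       AncEq p y x ⊎ Below y x

  search-init : Search (λ _ → nothing) (start G ∷ []) (λ _ → 0) 0
  search-init = record
    { start-rootless = refl ; parent-arc = λ () ; parent-visited = λ ()
    ; chain = bottom refl ; unique = [] ∷ []
    ; stack-visited = λ { (here e) → inj₁ e }
    ; post<clock = λ f → ⊥-elim (none f)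
    ; children-first = λ ()
    ; heads-visited = λ f → ⊥-elim (none f)
    ; heads = λ f → ⊥-elim (none f)
    ; parents = λ f → ⊥-elim (none f)
    }
    where
    none : ∀ {x} → ¬ Finished (λ _ → nothing) (start G ∷ []) x
    none (inj₁ e , x∉) = x∉ (here e)

  -- The new tree arc joins two vertices on the stack, so the clauses about finished vertices say
  -- nothing new about it.
  search-visit : ∀ {v vs p w post k} → (v , w) ∈ arcs G → ¬ Visited G p w →
    Search p (v ∷ vs) post k → Search (update w (just v) p) (w ∷ v ∷ vs) post k
  search-visit {v} {vs} {p} {w} {post} {k} vw∈ ¬vis S = record
    { start-rootless = trans (update-≢ w p _ (¬vis ∘ inj₁ ∘ sym)) start-rootless
    ; parent-arc = λ {x} e → case-parent {x} e (λ { refl refl → vw∈ }) λ e′ → parent-arc e′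
    ; parent-visited = λ {x} e → case-parent {x} e
        (λ { refl refl → visited⁺ (stack-visited (here refl)) })
        (λ e′ → visited⁺ (parent-visited e′))
    ; chain = link (update-≡ w p w refl) (chain-mono (λ x∈ → update-≢ w p _ (visited-≢ (stack-visited x∈))) chain)
    ; unique = All.¬Any⇒All¬ _ (¬vis ∘ stack-visited) ∷ unique
    ; stack-visited = λ { (here refl) → inj₂ (v , update-≡ w p w refl)
                        ; (there x∈) → visited⁺ (stack-visited x∈) }
    ; post<clock = post<clock ∘ finished⁻
    ; children-first = λ {x} e fy → case-parent {x} e
        (λ { refl refl → ⊥-elim (proj₂ fy (there (here refl))) })
        (λ e′ → below⁺ (children-first e′ (finished⁻ fy)))
    ; heads-visited = λ fx a → visited⁺ (heads-visited (finished⁻ fx) a)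
    ; heads = λ fx a → sees⁺ (heads (finished⁻ fx) a)
    ; parents = λ { fx (fz , lt) e → case-parent e
        (λ { refl refl → ⊥-elim (proj₂ fz (here refl)) })
        (λ e′ → sees⁺ (parents (finished⁻ fx) (finished⁻ fz , lt) e′)) }
    }
    where
    open Search S
    p′ = update w (just v) p

    visited-≢ : ∀ {x} → Visited G p x → x ≢ w
    visited-≢ vis refl = ¬vis vis

    parent⁺ : ∀ {x y} → p x ≡ just y → p′ x ≡ just y
    parent⁺ e = trans (update-≢ w p _ (visited-≢ (inj₂ (_ , e)))) e

    visited⁺ : ∀ {x} → Visited G p x → Visited G p′ x
    visited⁺ (inj₁ e)       = inj₁ e
    visited⁺ (inj₂ (y , e)) = inj₂ (y , parent⁺ e)

    case-parent : ∀ {x y} {C : Set} → p′ x ≡ just y →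
      (x ≡ w → v ≡ y → C) → (p x ≡ just y → C) → C
    case-parent {x} e f g with x ≟ w
    ... | yes x≡w = f x≡w (just-injective e)
    ... | no  _   = g e

    finished⁺ : ∀ {x} → Finished p (v ∷ vs) x → Finished p′ (w ∷ v ∷ vs) x
    finished⁺ (vis , x∉) = visited⁺ vis , λ { (here refl) → ¬vis vis ; (there x∈) → x∉ x∈ }

    finished⁻ : ∀ {x} → Finished p′ (w ∷ v ∷ vs) x → Finished p (v ∷ vs) x
    finished⁻ (inj₁ e , x∉)       = inj₁ e , x∉ ∘ there
    finished⁻ {x} (inj₂ (y , e) , x∉) =
      case-parent e (λ { refl _ → ⊥-elim (x∉ (here refl)) }) (λ e′ → inj₂ (y , e′)) , x∉ ∘ there

    below⁺ : ∀ {x y} → Below x y → Finished p′ (w ∷ v ∷ vs) x × post x < post y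
    below⁺ (f , lt) = finished⁺ f , lt

    sees⁺ : ∀ {x y} → AncEq p y x ⊎ Below y x →
      AncEq p′ y x ⊎ (Finished p′ (w ∷ v ∷ vs) y × post y < post x)
    sees⁺ (inj₁ q) = inj₁ (ancEq-mono parent⁺ q)
    sees⁺ (inj₂ b) = inj₂ (below⁺ b)

  search-retreat : ∀ {v vs p post k} → (∀ w → (v , w) ∈ arcs G → Visited G p w) →
    Search p (v ∷ vs) post k → Search p vs (update v k post) (suc k)
  search-retreat {v} {vs} {p} {post} {k} all-visited S = record
    { start-rootless = start-rootless ; parent-arc = parent-arc ; parent-visited = parent-visited
    ; chain = chain-tail chain ; unique = unique-tail unique
    ; stack-visited = stack-visited ∘ there
    ; post<clock = clock′
    ; children-first = children′
    ; heads-visited = heads-visited′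
    ; heads = heads′
    ; parents = parents′
    }
    where
    open Search S
    post′ = update v k post

    Below′ : Fin n → Fin n → Set
    Below′ y x = Finished p vs y × post′ y < post′ x

    unique-tail : Unique (v ∷ vs) → Unique vs
    unique-tail (_ ∷ u) = u

    v∉vs : v ∉ vs
    v∉vs v∈ with v≢ ∷ _ ← unique = All.lookup v≢ v∈ refl

    finished⁺ : ∀ {x} → Finished p (v ∷ vs) x → Finished p vs x
    finished⁺ (vis , x∉) = vis , x∉ ∘ there

    finished⁻ : ∀ {x} → Finished p vs x → x ≡ v ⊎ Finished p (v ∷ vs) x
    finished⁻ {x} (vis , x∉) with x ≟ v
    ... | yes x≡v = inj₁ x≡v
    ... | no  x≢v = inj₂ (vis , λ { (here x≡v) → x≢v x≡v ; (there x∈) → x∉ x∈ })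

    post′-v : post′ v ≡ k
    post′-v = update-≡ v post v refl

    post′-old : ∀ {x} → Finished p (v ∷ vs) x → post′ x ≡ post x
    post′-old (_ , x∉) = update-≢ v post _ (λ { refl → x∉ (here refl) })

    below-v : ∀ {x} → Finished p (v ∷ vs) x → Below′ x v
    below-v f rewrite post′-v | post′-old f = finished⁺ f , post<clock f

    below⁺ : ∀ {x y} → Finished p (v ∷ vs) y → Below x y → Below′ x y
    below⁺ fy (fx , lt) rewrite post′-old fx | post′-old fy = finished⁺ fx , lt

    sees⁺ : ∀ {x y} → Finished p (v ∷ vs) x → AncEq p y x ⊎ Below y x → AncEq p y x ⊎ Below′ y x
    sees⁺ fx (inj₁ q) = inj₁ q
    sees⁺ fx (inj₂ b) = inj₂ (below⁺ fx b)

    -- When the search retreats from `v`, a visited vertex is either on the stack, hence on the tree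
    -- path to `v`, or already finished, hence numbered before `v`, which receives the largest
    -- number so far.
    visited-from-v : ∀ {y} → Visited G p y → AncEq p y v ⊎ Below′ y v
    visited-from-v {y} vis with y ∈? (v ∷ vs)
    ... | yes y∈ = inj₁ (chain-ancestor chain y∈)
    ... | no  y∉ = inj₂ (below-v (vis , y∉))

    clock′ : ∀ {x} → Finished p vs x → post′ x < suc k
    clock′ f with finished⁻ f
    ... | inj₁ refl rewrite post′-v = n<1+n k
    ... | inj₂ f′ rewrite post′-old f′ = m<n⇒m<1+n (post<clock f′)

    children′ : ∀ {x y} → p x ≡ just y → Finished p vs y → Below′ x y
    children′ {x} e fy with finished⁻ fy
    -- A child of `v` still on the stack would put its parent `v` further down the stack, against
    -- uniqueness.
    ... | inj₁ refl = below-v (inj₂ (_ , e) , λ x∈ → v∉vs (chain-parent chain x∈ e))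
    ... | inj₂ fy′  = below⁺ fy′ (children-first e fy′)

    heads-visited′ : ∀ {x y} → Finished p vs x → (x , y) ∈ arcs G → Visited G p y
    heads-visited′ fx a with finished⁻ fx
    ... | inj₁ refl = all-visited _ a
    ... | inj₂ fx′  = heads-visited fx′ a

    heads′ : ∀ {x y} → Finished p vs x → (x , y) ∈ arcs G → AncEq p y x ⊎ Below′ y x
    heads′ fx a with finished⁻ fx
    ... | inj₁ refl = visited-from-v (all-visited _ a)
    ... | inj₂ fx′  = sees⁺ fx′ (heads fx′ a)

    parents′ : ∀ {x y z} → Finished p vs x → Below′ z x → p z ≡ just y → AncEq p y x ⊎ Below′ y x
    parents′ fx (fz , lt) e with finished⁻ fx
    ... | inj₁ refl = visited-from-v (parent-visited e)
    ... | inj₂ fx′ with finished⁻ fz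
    ...   | inj₁ refl rewrite post′-v | post′-old fx′ = ⊥-elim (<-irrefl refl (<-trans lt (post<clock fx′)))
    ...   | inj₂ fz′ rewrite post′-old fx′ | post′-old fz′ = sees⁺′ (parents fx′ (fz′ , lt) e)
      where
      sees⁺′ : ∀ {x y} → AncEq p y x ⊎ Below y x → AncEq p y x ⊎ (Finished p vs y × post′ y < post x)
      sees⁺′ (inj₁ q) = inj₁ q
      sees⁺′ (inj₂ (fy , lt′)) rewrite post′-old fy = inj₂ (finished⁺ fy , lt′)

  search-run : ∀ {stack p q post k} → Star (DFSStep G) (dfs stack p) (dfs [] q) →
    Search p stack post k → ∃₂ λ post′ k′ → Search q [] post′ k′
  search-run ε                  S = _ , _ , S
  search-run (visit a ¬vis ◅ r) S = search-run r (search-visit a ¬vis S)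
  search-run (retreat all ◅ r)  S = search-run r (search-retreat all S)

  all-visited : ∀ {p post k} → Search p [] post k → ∀ x → Visited G p x
  all-visited {p} S x = along (reachable G x) (inj₁ refl)
    where
    along : ∀ {y z} → Star (FlowArc G) y z → Visited G p y → Visited G p z
    along ε       vis = vis
    along (a ◅ r) vis = along r (Search.heads-visited S (vis , λ ()) a)

  -- This is all that the later arguments use of the search. `nested` is kept because it restores
  -- `arc-direction` after a contraction; `bound` makes induction towards larger post-order numbers
  -- well founded.
  record PostOrder (p : Parent n) : Set where
    field
      post           : Fin n → ℕ
      bound          : ℕ
      post<bound     : ∀ x → post x < bound
      start-rootless : p (start G) ≡ nothing
      tree-arc       : ∀ {x} → x ≢ start G → ∃ λ y → p x ≡ just y × (y , x) ∈ arcs G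
      post-mono      : ∀ {x y} → p x ≡ just y → post x < post y
      -- The subtree of y occupies an interval of the post-order.
      nested         : ∀ {x y z} → p z ≡ just y → post z < post x → AncEq p y x ⊎ post y < post x
      arc-direction  : ∀ {x y} → (x , y) ∈ arcs G → AncEq p y x ⊎ post y < post x

  postOrder : ∀ {p} → IsDFSTree G p → PostOrder p
  postOrder {p} run with post , k , S ← search-run run search-init = record
    { post = post ; bound = k
    ; post<bound = λ x → post<clock (finished x)
    ; start-rootless = start-rootless
    ; tree-arc = tree-arc
    ; post-mono = λ e → proj₂ (children-first e (finished _))
    ; nested = λ e lt → forget (parents (finished _) (finished _ , lt) e)
    ; arc-direction = λ a → forget (heads (finished _) a)
    }
    where
    open Search S

    finished : ∀ x → Finished p [] x
    finished x = all-visited S x , λ ()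

    forget : ∀ {x y} → AncEq p y x ⊎ Below y x → AncEq p y x ⊎ post y < post x
    forget (inj₁ q)        = inj₁ q
    forget (inj₂ (_ , lt)) = inj₂ lt

    tree-arc : ∀ {x} → x ≢ start G → ∃ λ y → p x ≡ just y × (y , x) ∈ arcs G
    tree-arc {x} x≢s with all-visited S x
    ... | inj₁ x≡s     = ⊥-elim (x≢s x≡s)
    ... | inj₂ (y , e) = y , e , parent-arc e

-- Arc lists, marking, and contraction of a vertex into its parent.

replace-∈ : ∀ {A : Set} {a c : A} xs {ys} d → a ∈ xs ++ c ∷ ys → a ∈ xs ++ d ∷ ys ⊎ a ≡ c
replace-∈ []       d (here a≡c) = inj₂ a≡c
replace-∈ []       d (there a∈) = inj₁ (there a∈)
replace-∈ (x ∷ xs) d (here a≡x) = inj₁ (here a≡x)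
replace-∈ (x ∷ xs) d (there a∈) with replace-∈ xs d a∈
... | inj₁ a∈′ = inj₁ (there a∈′)
... | inj₂ a≡c = inj₂ a≡c

middle-∈ : ∀ {A : Set} {c : A} xs {ys} → c ∈ xs ++ c ∷ ys
middle-∈ xs = ∈-++⁺ʳ xs (here refl)

module _ {n : ℕ} where

  rename-≡ : ∀ (v pv : Fin n) {y} → y ≡ v → rename v pv y ≡ pv
  rename-≡ v pv {y} y≡v with y ≟ v
  ... | yes _   = refl
  ... | no  y≢v = ⊥-elim (y≢v y≡v)

  rename-≢ : ∀ (v pv : Fin n) {y} → y ≢ v → rename v pv y ≡ y
  rename-≢ v pv {y} y≢v with y ≟ v
  ... | yes y≡v = ⊥-elim (y≢v y≡v)
  ... | no  _   = refl

  contractPar⁺ : ∀ (p : Parent n) {v pv x y} → p x ≡ just y →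
    contractPar v pv p x ≡ just (rename v pv y)
  contractPar⁺ p e rewrite e = refl

  contractPar⁻ : ∀ (p : Parent n) {v pv x y′} → contractPar v pv p x ≡ just y′ →
    ∃ λ y → p x ≡ just y × y′ ≡ rename v pv y
  contractPar⁻ p {x = x} e with p x
  ... | just y = y , refl , sym (just-injective e)

  remove : Fin n → List (Fin n) → List (Fin n)
  remove v = filter (λ y → ¬? (y ≟ v))

  remove-⁺ : ∀ {v x xs} → x ∈ xs → x ≢ v → x ∈ remove v xs
  remove-⁺ = ∈-filter⁺ (λ y → ¬? (y ≟ _))

  remove-⁻ : ∀ {v x} xs → x ∈ remove v xs → x ∈ xs × x ≢ v
  remove-⁻ xs = ∈-filter⁻ (λ y → ¬? (y ≟ _)) {xs = xs}

  length-remove : ∀ {v xs} → v ∈ xs → length (remove v xs) < length xs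
  length-remove {v} {xs} v∈ =
    filter-notAll (λ y → ¬? (y ≟ v)) xs (Any.map (λ v≡y y≢v → y≢v (sym v≡y)) v∈)

  Edge : List (Arc n) → Rel
  Edge as t x = ∃ λ b → (t , x , b) ∈ as

  edge-replace : ∀ xs {ys u v b b′ t x} →
    Edge (xs ++ (u , v , b) ∷ ys) t x → Edge (xs ++ (u , v , b′) ∷ ys) t x
  edge-replace xs {u = u} {v} {b′ = b′} (b , a∈) with replace-∈ xs (u , v , b′) a∈
  ... | inj₁ a∈′  = b , a∈′
  ... | inj₂ refl = _ , middle-∈ xs

  unmarkedCount : List (Arc n) → ℕ
  unmarkedCount []                     = 0
  unmarkedCount ((_ , _ , true) ∷ as)  = unmarkedCount as
  unmarkedCount ((_ , _ , false) ∷ as) = suc (unmarkedCount as)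

  unmarkedCount-mark : ∀ xs {ys u v} →
    unmarkedCount (xs ++ (u , v , true) ∷ ys) < unmarkedCount (xs ++ (u , v , false) ∷ ys)
  unmarkedCount-mark []                     = n<1+n _
  unmarkedCount-mark ((_ , _ , true) ∷ xs)  = unmarkedCount-mark xs
  unmarkedCount-mark ((_ , _ , false) ∷ xs) = s≤s (unmarkedCount-mark xs)

  contract-∈⁺ : ∀ (v pv : Fin n) {as t x b} → (t , x , b) ∈ as →
    (rename v pv t , rename v pv x , b) ∈ contractArcs v pv as
  contract-∈⁺ v pv (here refl) = here refl
  contract-∈⁺ v pv (there a∈)  = there (contract-∈⁺ v pv a∈)

  contract-∈⁻ : ∀ (v pv : Fin n) {as t′ x′ b} → (t′ , x′ , b) ∈ contractArcs v pv as →
    ∃₂ λ t x → (t , x , b) ∈ as × t′ ≡ rename v pv t × x′ ≡ rename v pv x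
  contract-∈⁻ v pv a∈ with (t , x , b) , a∈′ , refl ← ∈-map⁻ _ a∈ = t , x , a∈′ , refl , refl

  assignAll-∈ : ∀ {ws} (u : Fin n) d {w} → w ∈ ws → assignAll ws u d w ≡ just u
  assignAll-∈ {z ∷ ws} u d {w} w∈ with w ≟ z
  assignAll-∈ {z ∷ ws} u d {w} w∈         | yes _   = refl
  assignAll-∈ {z ∷ ws} u d {w} (here w≡z) | no  w≢z = ⊥-elim (w≢z w≡z)
  assignAll-∈ {z ∷ ws} u d {w} (there w∈) | no  _   = assignAll-∈ u d w∈

  assignAll-∉ : ∀ {ws} (u : Fin n) d {w} → w ∉ ws → assignAll ws u d w ≡ d w
  assignAll-∉ {[]}     u d     w∉ = refl
  assignAll-∉ {z ∷ ws} u d {w} w∉ with w ≟ z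
  ... | yes w≡z = ⊥-elim (w∉ (here w≡z))
  ... | no  _   = assignAll-∉ u d (w∉ ∘ there)

  step0-∈ : ∀ {p : Parent n} {u v as ns t x b} → Step0 p u v as ns → (t , x , b) ∈ ns →
    b ≡ false × p u ≡ just t × Edge as v x × PAnc p u x
  step0-∈ (keep (refl , anc , _) e _) (here refl) = refl , e , (_ , here refl) , anc
  step0-∈ (keep _ _ z) (there a∈) with b≡ , e , (c , a∈′) , anc ← step0-∈ z a∈ =
    b≡ , e , (c , there a∈′) , anc
  step0-∈ (skip _ z) a∈ with b≡ , e , (c , a∈′) , anc ← step0-∈ z a∈ =
    b≡ , e , (c , there a∈′) , anc

  -- `Step0Cond` is not decided here, so existence is only doubly negated; that suffices to refute
  -- that a state is stuck.
  step0-exists : ∀ (p : Parent n) u v as → ¬ ¬ ∃ (Step0 p u v as)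
  step0-exists p u v []       ¬ex = ¬ex ([] , [])
  step0-exists p u v (a ∷ as) ¬ex = step0-exists p u v as λ { (ns , z) →
    ¬ex (_ , skip (λ { (c , pu , e) → ¬ex (_ , keep c e z) }) z) }

  tree-or-forward : ∀ {p : Parent n} {u v} → PAnc p u v → TreeArc p u v ⊎ ForwardArc p u v
  tree-or-forward (par e)  = inj₁ e
  tree-or-forward (up e q) = inj₂ (_ , e , q)

  tree-or-forward⁻ : ∀ {p : Parent n} {u v} → TreeArc p u v ⊎ ForwardArc p u v → PAnc p u v
  tree-or-forward⁻ (inj₁ e)           = par e
  tree-or-forward⁻ (inj₂ (_ , e , q)) = up e q

  module Contracted (p : Parent n) (v pv : Fin n) (e-v : p v ≡ just pv) (pv≢v : pv ≢ v) where

    ren : Fin n → Fin n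
    ren = rename v pv

    p′ : Parent n
    p′ = contractPar v pv p

    ren-v : ren v ≡ pv
    ren-v = rename-≡ v pv refl

    ren-≢ : ∀ {y} → y ≢ v → ren y ≡ y
    ren-≢ = rename-≢ v pv

    parent-≢ : ∀ {x y} → p x ≡ just y → y ≢ v → p′ x ≡ just y
    parent-≢ e y≢v = trans (contractPar⁺ p e) (cong just (ren-≢ y≢v))

    -- Contraction only redirects pointers: the removed `v` still points to `pv`. Ancestor chains
    -- through `v` can therefore be followed in the new tree first and shortened afterwards.
    parent-v : p′ v ≡ just pv
    parent-v = parent-≢ e-v pv≢v

    panc⁺ : ∀ {a x} → a ≢ v → PAnc p a x → PAnc p′ a x
    panc⁺ a≢v (par e) = par (parent-≢ e a≢v)
    panc⁺ {a} {x} a≢v (up {z = z} e q) with z ≟ v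
    ... | no  z≢v  = up (parent-≢ e z≢v) (panc⁺ a≢v q)
    ... | yes refl with ancestor-via-parent p′ parent-v (panc⁺ a≢v q)
    ...   | inj₁ refl = par (trans (contractPar⁺ p e) (cong just ren-v))
    ...   | inj₂ q′   = up (trans (contractPar⁺ p e) (cong just ren-v)) q′

    panc-step : ∀ {a x y} → p′ x ≡ just y → AncEq p a y → PAnc p a x
    panc-step e q with z , e′ , refl ← contractPar⁻ p e with z ≟ v | q
    ... | no  _    | inj₁ refl = par e′
    ... | no  _    | inj₂ q′   = up e′ q′
    ... | yes refl | inj₁ refl = up e′ (par e-v)
    ... | yes refl | inj₂ q′   = up e′ (up e-v q′)

    panc⁻ : ∀ {a x} → PAnc p′ a x → PAnc p a x
    panc⁻ (par e)  = panc-step e (inj₁ refl)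
    panc⁻ (up e q) = panc-step e (inj₂ (panc⁻ q))

    ancEq-≢ : ∀ {a x} → a ≢ v → AncEq p a x → AncEq p′ a x
    ancEq-≢ a≢v (inj₁ e) = inj₁ e
    ancEq-≢ a≢v (inj₂ q) = inj₂ (panc⁺ a≢v q)

    ancEq-ren : ∀ {a x} → a ≢ v → AncEq p a x → AncEq p′ a (ren x)
    ancEq-ren {a} {x} a≢v q with x ≟ v
    ... | no  _ = ancEq-≢ a≢v q
    ancEq-ren a≢v (inj₁ a≡v) | yes refl = ⊥-elim (a≢v a≡v)
    ancEq-ren a≢v (inj₂ q)   | yes refl = ancEq-≢ a≢v (ancestor-via-parent p e-v q)

    ancEq⁺ : ∀ {a x} → AncEq p a x → AncEq p′ (ren a) (ren x)
    ancEq⁺ (inj₁ refl) = inj₁ refl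
    ancEq⁺ {a} (inj₂ q) with a ≟ v
    ... | no  a≢v  = ancEq-ren a≢v (inj₂ q)
    ... | yes refl = ancEq-ren pv≢v (inj₂ (panc-trans-parent e-v q))

    ancEq⁻ : ∀ {x t} → x ≢ v → AncEq p′ x (ren t) → AncEq p x t
    ancEq⁻ {x} {t} x≢v q with t ≟ v | q
    ... | no  _    | inj₁ e    = inj₁ e
    ... | no  _    | inj₂ q′   = inj₂ (panc⁻ q′)
    ... | yes refl | inj₁ refl = inj₂ (par e-v)
    ... | yes refl | inj₂ q′   = inj₂ (up e-v (panc⁻ q′))

-- Structure of the current graph and its stability under shortcuts and contraction.

module Correctness {n} (G : FlowGraph n) (num : Permutation′ n) (post : Fin n → ℕ) where

  s : Fin n
  s = start G

  N : Fin n → ℕ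
  N x = toℕ (num ⟨$⟩ʳ x)

  N<n : ∀ x → N x < n
  N<n x = toℕ<n (num ⟨$⟩ʳ x)

  N-vertexAt : ∀ i (i<n : i < n) → N (vertexAt num i i<n) ≡ i
  N-vertexAt i i<n = trans (cong toℕ (inverseʳ num)) (toℕ-fromℕ< i<n)

  N-injective : ∀ {x y} → N x ≡ N y → x ≡ y
  N-injective e = trans (sym (inverseˡ num)) (trans (cong (num ⟨$⟩ˡ_) (toℕ-injective e)) (inverseˡ num))

  N-<-≢ : ∀ {x y} → N x < N y → x ≢ y
  N-<-≢ lt refl = <-irrefl refl lt

  -- `alive` lists the vertices not yet contracted away. The numbers `N` and `post` stay those of
  -- the original tree throughout, while `p` and `E` change.
  record Shape (E : Rel {n}) (p : Parent n) (alive : List (Fin n)) : Set where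
    field
      ends-alive     : ∀ {t x} → E t x → t ∈ alive × x ∈ alive
      tree-arc       : ∀ {x} → x ∈ alive → x ≢ s → ∃ λ y → p x ≡ just y × E y x
      start-rootless : p s ≡ nothing
      num-mono       : ∀ {x y} → p x ≡ just y → N x < N y
      post-mono      : ∀ {x y} → p x ≡ just y → post x < post y
      nested         : ∀ {x y z} → p z ≡ just y → post z < post x → AncEq p y x ⊎ post y < post x
      arc-direction  : ∀ {t x} → E t x → AncEq p x t ⊎ post x < post t

    ancestor-num : ∀ {a x} → PAnc p a x → N x < N a
    ancestor-num (par e)  = num-mono e
    ancestor-num (up e q) = <-trans (num-mono e) (ancestor-num q)

    ancestor-post : ∀ {a x} → PAnc p a x → post x < post a
    ancestor-post (par e)  = post-mono e
    ancestor-post (up e q) = <-trans (post-mono e) (ancestor-post q)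

    child-≢s : ∀ {x y} → p x ≡ just y → x ≢ s
    child-≢s e refl with () ← trans (sym e) start-rootless

    descendant-≢s : ∀ {a x} → PAnc p a x → x ≢ s
    descendant-≢s q = child-≢s (proj₂ (has-parent q))

    parent-arc : ∀ {x y} → x ∈ alive → p x ≡ just y → E y x
    parent-arc x∈ e with y′ , e′ , a ← tree-arc x∈ (child-≢s e) =
      subst (λ y → E y _) (just-unique p e′ e) a

    -- Numbers fall along the tree path from `a` down to `x`, so no vertex on it below `a` can be
    -- `b`.
    descend : ∀ {a b x} → N a ≤ N b → x ∈ alive → PAnc p a x →
      Avoiding E s b a → Avoiding E s b x
    descend a≤b x∈ (par e) r =
      extend r (parent-arc x∈ e) (N-<-≢ (<-≤-trans (num-mono e) a≤b))
    descend a≤b x∈ q@(up e q′) r =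
      extend (descend a≤b (proj₁ (ends-alive a)) q′ r) a (N-<-≢ (<-≤-trans (ancestor-num q) a≤b))
      where a = parent-arc x∈ e

    -- Climb from `x`: a parent other than `u` is again dominated by `u`, since a walk avoiding `u`
    -- would extend along the tree arc. Numbers grow on the way up, and a root different from `u` is
    -- not dominated by `u`, so the climb meets `u`.
    dominator-ancestor : ∀ {u x} → x ∈ alive → x ≢ u → ¬ Avoiding E s u x → PAnc p u x
    dominator-ancestor x∈ x≢u ¬r = go (<-wellFounded _) x∈ x≢u ¬r
      where
      go : ∀ {u x} → Acc _<_ (n ∸ N x) → x ∈ alive → x ≢ u → ¬ Avoiding E s u x → PAnc p u x
      go {u} {x} (acc rec) x∈ x≢u ¬r with x ≟ s
      ... | yes refl = ⊥-elim (¬r (source x≢u))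
      ... | no  x≢s with y , e , a ← tree-arc x∈ x≢s with y ≟ u
      ...   | yes refl = par e
      ...   | no  y≢u  = up e (go (rec (∸-monoʳ-< (num-mono e) (<⇒≤ (N<n y))))
                               (proj₁ (ends-alive a)) y≢u (λ r → ¬r (extend r a x≢u)))

  shape-⇔ : ∀ {E E′ p alive} → (∀ {t x} → E t x → E′ t x) → (∀ {t x} → E′ t x → E t x) →
    Shape E p alive → Shape E′ p alive
  shape-⇔ to from S = record
    { ends-alive = ends-alive ∘ from
    ; tree-arc = λ x∈ x≢s → let y , e , a = tree-arc x∈ x≢s in y , e , to a
    ; start-rootless = start-rootless ; num-mono = num-mono ; post-mono = post-mono
    ; nested = nested ; arc-direction = arc-direction ∘ from
    }
    where open Shape S

  module Shortcuts {E E′ : Rel {n}} {p alive} (S : Shape E p alive) {u v : Fin n} (u∈ : u ∈ alive)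
    (to : ∀ {t x} → E t x → E′ t x)
    (from : ∀ {t x} → E′ t x → E t x ⊎ (p u ≡ just t × E v x × PAnc p u x)) where

    open Shape S

    shape : Shape E′ p alive
    shape = record
      { ends-alive = ends-alive′
      ; tree-arc = λ x∈ x≢s → let y , e , a = tree-arc x∈ x≢s in y , e , to a
      ; start-rootless = start-rootless ; num-mono = num-mono ; post-mono = post-mono
      ; nested = nested ; arc-direction = arc-direction′
      }
      where
      ends-alive′ : ∀ {t x} → E′ t x → t ∈ alive × x ∈ alive
      ends-alive′ a with from a
      ... | inj₁ a′           = ends-alive a′
      ... | inj₂ (e , a′ , _) = proj₁ (ends-alive (parent-arc u∈ e)) , proj₂ (ends-alive a′)

      arc-direction′ : ∀ {t x} → E′ t x → AncEq p x t ⊎ post x < post t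
      arc-direction′ a with from a
      ... | inj₁ a′          = arc-direction a′
      ... | inj₂ (e , _ , q) = inj₂ (<-trans (ancestor-post q) (post-mono e))

    -- A new arc from the parent of `u` is replaced by the tree arc to `u`, the tree path down to
    -- `v` and the old arc out of `v`. Before the head, this route has only vertices numbered at
    -- most `N u` after its start, so it misses `b`.
    avoiding⁻ : ∀ {b x} → N u < N b → v ∈ alive → PAnc p u v → Avoiding E′ s b x → Avoiding E s b x
    avoiding⁻ {b} u<b v∈ u-v = avoiding-lift step-back
      where
      step-back : ∀ {t x} → E′ t x → Avoiding E s b t → x ≢ b → Avoiding E s b x
      step-back a r x≢b with from a
      ... | inj₁ a′           = extend r a′ x≢b
      ... | inj₂ (e , a′ , _) =
        extend (descend (<⇒≤ u<b) v∈ u-v (extend r (parent-arc u∈ e) (N-<-≢ u<b))) a′ x≢b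

  module Contracting {E E′ : Rel {n}} {p alive} (S : Shape E p alive) {v pv : Fin n}
    (v∈ : v ∈ alive) (e-v : p v ≡ just pv)
    (to : ∀ {t x} → E t x → E′ (rename v pv t) (rename v pv x))
    (from : ∀ {t′ x′} → E′ t′ x′ →
      ∃₂ λ t x → E t x × t′ ≡ rename v pv t × x′ ≡ rename v pv x) where

    open Shape S

    pv≢v : pv ≢ v
    pv≢v refl = N-<-≢ (num-mono e-v) refl

    open Contracted p v pv e-v pv≢v public

    pv∈ : pv ∈ alive
    pv∈ = proj₁ (ends-alive (parent-arc v∈ e-v))

    v≢s : v ≢ s
    v≢s = child-≢s e-v

    -- A tail `v` moves up to `pv`, which is still `u` or below `u`; this keeps the bound on the
    -- tails of marked arcs.
    ren-num : ∀ {u t i} → PAnc p u v → N u ≡ i → N t ≤ i → N (ren t) ≤ i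
    ren-num {t = t} u-v refl t≤u with t ≟ v
    ... | no  _ = t≤u
    ... | yes _ with ancestor-via-parent p e-v u-v
    ...   | inj₁ refl = ≤-refl
    ...   | inj₂ q    = <⇒≤ (ancestor-num q)

    private
      ren-∈ : ∀ {y} → y ∈ alive → ren y ∈ remove v alive
      ren-∈ {y} y∈ with y ≟ v
      ... | yes _   = remove-⁺ pv∈ pv≢v
      ... | no  y≢v = remove-⁺ y∈ y≢v

      N-ren : ∀ y → N y ≤ N (ren y)
      N-ren y with y ≟ v
      ... | yes refl = <⇒≤ (num-mono e-v)
      ... | no  _    = ≤-refl

      post-ren : ∀ y → post y ≤ post (ren y)
      post-ren y with y ≟ v
      ... | yes refl = <⇒≤ (post-mono e-v)
      ... | no  _    = ≤-refl

    shape : Shape E′ p′ (remove v alive)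
    shape = record
      { ends-alive = ends-alive′
      ; tree-arc = tree-arc′
      ; start-rootless = start-rootless′
      ; num-mono = num-mono′
      ; post-mono = post-mono′
      ; nested = nested′
      ; arc-direction = arc-direction′
      }
      where
      ends-alive′ : ∀ {t x} → E′ t x → t ∈ remove v alive × x ∈ remove v alive
      ends-alive′ a with t , x , a′ , refl , refl ← from a =
        ren-∈ (proj₁ (ends-alive a′)) , ren-∈ (proj₂ (ends-alive a′))

      tree-arc′ : ∀ {x} → x ∈ remove v alive → x ≢ s → ∃ λ y → p′ x ≡ just y × E′ y x
      tree-arc′ x∈ x≢s with x∈′ , x≢v ← remove-⁻ alive x∈ with y , e , a ← tree-arc x∈′ x≢s =
        ren y , contractPar⁺ p e , subst (E′ (ren y)) (ren-≢ x≢v) (to a)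

      start-rootless′ : p′ s ≡ nothing
      start-rootless′ rewrite start-rootless = refl

      num-mono′ : ∀ {x y} → p′ x ≡ just y → N x < N y
      num-mono′ e with y , e′ , refl ← contractPar⁻ p e = <-≤-trans (num-mono e′) (N-ren y)

      post-mono′ : ∀ {x y} → p′ x ≡ just y → post x < post y
      post-mono′ e with y , e′ , refl ← contractPar⁻ p e = <-≤-trans (post-mono e′) (post-ren y)

      -- For a former child of `v`, nesting is used twice: once at its old parent `v`, and, if `v`
      -- precedes `x`, once more at the tree arc from `pv` to `v`.
      nested-pv : ∀ {x} → AncEq p v x ⊎ post v < post x → AncEq p′ pv x ⊎ post pv < post x
      nested-pv (inj₁ (inj₁ refl)) = inj₁ (inj₂ (par parent-v))
      nested-pv (inj₁ (inj₂ q))    = inj₁ (inj₂ (panc⁺ pv≢v (panc-trans-parent e-v q)))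
      nested-pv (inj₂ lt) with nested e-v lt
      ... | inj₁ q   = inj₁ (ancEq-≢ pv≢v q)
      ... | inj₂ lt′ = inj₂ lt′

      nested′ : ∀ {x y z} → p′ z ≡ just y → post z < post x → AncEq p′ y x ⊎ post y < post x
      nested′ e lt with y , e′ , refl ← contractPar⁻ p e with y ≟ v | nested e′ lt
      ... | yes refl | d        = nested-pv d
      ... | no  y≢v  | inj₁ q   = inj₁ (ancEq-≢ y≢v q)
      ... | no  _    | inj₂ lt′ = inj₂ lt′

      -- Renaming a tail can only raise its post-order number. Raising a head from `v` to `pv` may
      -- spoil the inequality, but then `nested` makes `pv` an ancestor of the tail or the tail
      -- itself.
      direction-ren : ∀ {t x} → AncEq p x t ⊎ post x < post t →
        AncEq p′ (ren x) (ren t) ⊎ post (ren x) < post (ren t)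
      direction-ren (inj₁ q) = inj₁ (ancEq⁺ q)
      direction-ren {t} {x} (inj₂ lt) with x ≟ v
      ... | no  _    = inj₂ (<-≤-trans lt (post-ren t))
      ... | yes refl with nested e-v lt
      ...   | inj₁ q   = inj₁ (ancEq-ren pv≢v q)
      ...   | inj₂ lt′ = inj₂ (<-≤-trans lt′ (post-ren t))

      arc-direction′ : ∀ {t x} → E′ t x → AncEq p′ x t ⊎ post x < post t
      arc-direction′ a with t , x , a′ , refl , refl ← from a = direction-ren (arc-direction a′)

    -- `lift-v` is what each loop has to supply; the way back from `pv` to `v` is the tree arc. It
    -- also covers `b` equal to `pv`, where it says that `pv` dominates `v`.
    module _ {b} (v≢b : v ≢ b) (lift-v : Avoiding E s b v → Avoiding E s b pv) where

      private
        ren⁻ : ∀ {t} → Avoiding E s b (ren t) → Avoiding E s b t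
        ren⁻ {t} r with t ≟ v
        ... | yes refl = extend r (parent-arc v∈ e-v) v≢b
        ... | no  _    = r

        unren-≢ : ∀ {x} → ren x ≢ b → x ≢ b
        unren-≢ {x} ren≢b with x ≟ v
        ... | yes refl = v≢b
        ... | no  _    = ren≢b

        ren⁺ : ∀ {x} → Avoiding E s b x → Avoiding E s b (ren x)
        ren⁺ {x} r with x ≟ v
        ... | yes refl = lift-v r
        ... | no  _    = r

      avoiding⁺ : ∀ {x} → x ≢ v → Avoiding E s b x → Avoiding E′ s b x
      avoiding⁺ x≢v r = subst (Avoiding E′ s b) (ren-≢ x≢v)
        (avoiding-map ren (ren-≢ (v≢s ∘ sym)) to (avoiding-≢ ∘ ren⁺) r)

      avoiding⁻ : ∀ {x} → Avoiding E′ s b x → Avoiding E s b x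
      avoiding⁻ = avoiding-lift step-back
        where
        step-back : ∀ {t x} → E′ t x → Avoiding E s b t → x ≢ b → Avoiding E s b x
        step-back a r x≢b with t , x , a′ , refl , refl ← from a =
          ren⁺ (extend (ren⁻ r) a′ (unren-≢ x≢b))

  -- Dominance in the input graph versus the current graph.

  -- Only unprocessed vertices (number at least b) keep their dominance relation under the
  -- contractions; processed vertices strictly dominate nothing that is still represented.
  record Doms (E : Rel {n}) (alive : List (Fin n)) (sm : Fin n → List (Fin n)) (b : ℕ) : Set where
    field
      self  : ∀ {x} → x ∈ alive → x ∈ sm x
      dom⇒ : ∀ {x w a} → x ∈ alive → x ≢ s → w ∈ sm x →
              StrictDom (FlowArc G) s a w → b ≤ N a × StrictDom E s a x
      dom⇐ : ∀ {x w a} → x ∈ alive → x ≢ s → w ∈ sm x →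
              b ≤ N a → StrictDom E s a x → StrictDom (FlowArc G) s a w

  doms-⇔ : ∀ {E E′ alive sm b} →
    (∀ {a x} → b ≤ N a → x ∈ alive → Avoiding E s a x → Avoiding E′ s a x) →
    (∀ {a x} → b ≤ N a → x ∈ alive → Avoiding E′ s a x → Avoiding E s a x) →
    Doms E alive sm b → Doms E′ alive sm b
  doms-⇔ to from D = record
    { self = self
    ; dom⇒ = λ x∈ x≢s w∈ sd → let b≤ , a≢x , ¬r = dom⇒ x∈ x≢s w∈ sd in
              b≤ , a≢x , ¬r ∘ from b≤ x∈
    ; dom⇐ = λ { x∈ x≢s w∈ b≤ (a≢x , ¬r) → dom⇐ x∈ x≢s w∈ b≤ (a≢x , ¬r ∘ to b≤ x∈) }
    }
    where open Doms D

  doms-remove : ∀ {E alive sm b v} → Doms E alive sm b → Doms E (remove v alive) sm b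
  doms-remove {alive = alive} D = record
    { self = λ x∈ → self (old x∈) ; dom⇒ = dom⇒ ∘ old ; dom⇐ = dom⇐ ∘ old }
    where
    open Doms D
    old : ∀ {v x} → x ∈ remove v alive → x ∈ alive
    old x∈ = proj₁ (remove-⁻ alive x∈)

  Merged : Fin n → Fin n → (Fin n → List (Fin n)) → Fin n → List (Fin n)
  Merged q v sm = update q (sm q ++ sm v) sm

  merged-old : ∀ q v sm {x w} → w ∈ sm x → w ∈ Merged q v sm x
  merged-old q v sm {x} w∈ with x ≟ q
  ... | yes refl = ∈-++⁺ˡ w∈
  ... | no  _    = w∈

  merged-new : ∀ q v sm {w} → w ∈ sm v → w ∈ Merged q v sm q
  merged-new q v sm w∈ with q ≟ q
  ... | yes _   = ∈-++⁺ʳ (sm q) w∈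
  ... | no  q≢q = ⊥-elim (q≢q refl)

  merged-∈ : ∀ q v sm {x w} → w ∈ Merged q v sm x → w ∈ sm x ⊎ (x ≡ q × w ∈ sm v)
  merged-∈ q v sm {x} w∈ with x ≟ q
  ... | no  _    = inj₁ w∈
  ... | yes refl with ∈-++⁻ (sm q) w∈
  ...   | inj₁ w∈q = inj₁ w∈q
  ...   | inj₂ w∈v = inj₂ (refl , w∈v)

  -- Both numbers lie below `b`, so neither `q` nor `v` is itself among the dominators considered,
  -- and the two rerouting hypotheses give them the same ones. The elements of `sm v` can thus be
  -- described by `q`.
  doms-merge : ∀ {E alive sm b q v} → v ∈ alive → v ≢ s → N q < b → N v < b →
    (∀ {a} → b ≤ N a → Avoiding E s a v → Avoiding E s a q) →
    (∀ {a} → b ≤ N a → Avoiding E s a q → Avoiding E s a v) →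
    Doms E alive sm b → Doms E alive (Merged q v sm) b
  doms-merge {E} {alive} {sm} {b} {q} {v} v∈ v≢s q<b v<b v⇒q q⇒v D = record
    { self = λ x∈ → merged-old q v sm (self x∈)
    ; dom⇒ = λ x∈ x≢s w∈ → to x∈ x≢s (merged-∈ q v sm w∈)
    ; dom⇐ = λ x∈ x≢s w∈ → from x∈ x≢s (merged-∈ q v sm w∈)
    }
    where
    open Doms D

    small-≢ : ∀ {a y} → N y < b → b ≤ N a → a ≢ y
    small-≢ y<b b≤a refl = N-<-≢ (<-≤-trans y<b b≤a) refl

    to : ∀ {x w a} → x ∈ alive → x ≢ s → w ∈ sm x ⊎ (x ≡ q × w ∈ sm v) →
      StrictDom (FlowArc G) s a w → b ≤ N a × StrictDom E s a x
    to x∈ x≢s (inj₁ w∈) sd = dom⇒ x∈ x≢s w∈ sd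
    to x∈ x≢s (inj₂ (refl , w∈)) sd with b≤a , _ , ¬r ← dom⇒ v∈ v≢s w∈ sd =
      b≤a , small-≢ q<b b≤a , ¬r ∘ q⇒v b≤a

    from : ∀ {x w a} → x ∈ alive → x ≢ s → w ∈ sm x ⊎ (x ≡ q × w ∈ sm v) →
      b ≤ N a → StrictDom E s a x → StrictDom (FlowArc G) s a w
    from x∈ x≢s (inj₁ w∈) b≤a sd = dom⇐ x∈ x≢s w∈ b≤a sd
    from x∈ x≢s (inj₂ (refl , w∈)) b≤a (_ , ¬r) =
      dom⇐ v∈ v≢s w∈ b≤a (small-≢ v<b b≤a , ¬r ∘ v⇒q b≤a)

  -- The invariant and the marking of an arc.

  index : Phase → ℕ
  index (loop1 i) = i
  index (loop2 i) = i

  processedBelow : Phase → ℕ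
  processedBelow (loop1 i) = i
  processedBelow (loop2 i) = suc i

  InRange : Phase → Set
  InRange (loop1 i) = i ≤ n
  InRange (loop2 i) = i < n

  -- A processed vertex regains a back or loop arc only during the second loop for u, and then
  -- it has itself an unmarked back arc to u, so it is contracted before that loop ends.
  Pending : List (Arc n) → Parent n → Phase → Fin n → Set
  Pending as p (loop1 i) x = ⊥
  Pending as p (loop2 i) x = ∃ λ u → N u ≡ i × (x , u , false) ∈ as × PAnc p u x

  Covered : List (Fin n) → (Fin n → List (Fin n)) → (Fin n → Maybe (Fin n)) → Set
  Covered alive sm d = ∀ w → w ≢ s →
    (∃ λ x → x ∈ alive × x ≢ s × w ∈ sm x) ⊎ (∃ λ x → d w ≡ just x × IsIdom G x w)

  covered-merge : ∀ {alive sm d q v} → q ∈ alive → q ≢ v → q ≢ s →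
    Covered alive sm d → Covered (remove v alive) (Merged q v sm) d
  covered-merge {sm = sm} {q = q} {v} q∈ q≢v q≢s C w w≢s with C w w≢s
  ... | inj₂ done = inj₂ done
  ... | inj₁ (x , x∈ , x≢s , w∈) with x ≟ v
  ...   | yes refl = inj₁ (q , remove-⁺ q∈ q≢v , q≢s , merged-new q v sm w∈)
  ...   | no  x≢v  = inj₁ (x , remove-⁺ x∈ x≢v , x≢s , merged-old q v sm w∈)

  -- A member of `sm v` that already has a value receives a correct one again, so membership alone
  -- decides the case.
  covered-assign : ∀ {alive sm d v u} → (∀ {w} → w ∈ sm v → IsIdom G u w) →
    Covered alive sm d → Covered (remove v alive) sm (assignAll (sm v) u d)
  covered-assign {sm = sm} {d} {v} {u} idom C w w≢s with w ∈? sm v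
  ... | yes w∈ = inj₂ (u , assignAll-∈ u d w∈ , idom w∈)
  ... | no  w∉ with C w w≢s
  ...   | inj₂ (x , e , i) = inj₂ (x , trans (assignAll-∉ u d w∉) e , i)
  ...   | inj₁ (x , x∈ , x≢s , w∈) =
    inj₁ (x , remove-⁺ x∈ (λ { refl → w∉ w∈ }) , x≢s , w∈)

  -- `marked` locates the tails of all arcs into a vertex about to be contracted in the first loop.
  -- `settled` excludes back and loop arcs when `dominates-none` looks for an unmarked arc into a
  -- processed vertex.
  record Core (σ : GDState n) (alive : List (Fin n)) : Set where
    field
      shape    : Shape (Edge (garcs σ)) (gpar σ) alive
      doms     : Doms (Edge (garcs σ)) alive (same σ) (processedBelow (phase σ))
      marked   : ∀ {t x} → (t , x , true) ∈ garcs σ → N t ≤ index (phase σ) × AncEq (gpar σ) t x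
      settled  : ∀ {t x} → (t , x , false) ∈ garcs σ → AncEq (gpar σ) x t →
                 N x < index (phase σ) → Pending (garcs σ) (gpar σ) (phase σ) x
      covered  : Covered alive (same σ) (dom σ)
      in-range : InRange (phase σ)

    open Shape shape public
    open Doms doms public

  -- `Except` admits the head of the arc just marked, which may have lost its last unmarked arc and
  -- is then contracted in the same step.
  Unfinished : (Fin n → Set) → List (Arc n) → List (Fin n) → Set
  Unfinished Except as alive = ∀ {x} → x ∈ alive → x ≢ s → ¬ Except x → ¬ AllMarkedInto x as

  Inv : GDState n → List (Fin n) → Set
  Inv σ alive = Core σ alive × Unfinished (λ _ → ⊥) (garcs σ) alive

  unfinished-mark : ∀ xs {ys u v alive} → Unfinished (λ _ → ⊥) (xs ++ (u , v , false) ∷ ys) alive →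
    Unfinished (_≡ v) (xs ++ (u , v , true) ∷ ys) alive
  unfinished-mark xs {ys} {u} {v} U {x} x∈ x≢s x≢v am = U x∈ x≢s (λ ()) marked-before
    where
    marked-before : ∀ t b → (t , x , b) ∈ xs ++ (u , v , false) ∷ ys → b ≡ true
    marked-before t b a∈ with replace-∈ xs (u , v , true) a∈
    ... | inj₁ a∈′  = am t b a∈′
    ... | inj₂ refl = ⊥-elim (x≢v refl)

  unfinished-contract : ∀ {v pv as alive} → Unfinished (_≡ v) as alive →
    Unfinished (λ _ → ⊥) (contractArcs v pv as) (remove v alive)
  unfinished-contract {v} {pv} {as} {alive} U {x} x∈ x≢s _ am with x∈′ , x≢v ← remove-⁻ alive x∈ =
    U x∈′ x≢s x≢v λ t b a∈ → am (rename v pv t) b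
      (subst (λ y → (rename v pv t , y , b) ∈ contractArcs v pv as) (rename-≢ v pv x≢v)
             (contract-∈⁺ v pv a∈))

  -- Serves both loops: `Pending` is empty in the first, and in the second the marked loop is at
  -- `u`, whose number is not below the index.
  mark-core : ∀ xs {ys u v p sm d φ alive} →
    Core (st (xs ++ (u , v , false) ∷ ys) p sm d φ) alive → N u ≤ index φ → AncEq p u v →
    (∀ {x} → N x < index φ → Pending (xs ++ (u , v , false) ∷ ys) p φ x →
             Pending (xs ++ (u , v , true) ∷ ys) p φ x) →
    Core (st (xs ++ (u , v , true) ∷ ys) p sm d φ) alive
  mark-core xs {ys} {u} {v} {p} {φ = φ} C u≤ u-v pending = record
    { shape = shape-⇔ (edge-replace xs) (edge-replace xs) shape
    ; doms = doms-⇔ (λ _ _ → avoiding-⊆ (edge-replace xs)) (λ _ _ → avoiding-⊆ (edge-replace xs)) doms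
    ; marked = marked′
    ; settled = settled′
    ; covered = covered ; in-range = in-range
    }
    where
    open Core C
    as′ = xs ++ (u , v , true) ∷ ys

    marked′ : ∀ {t x} → (t , x , true) ∈ as′ → N t ≤ index φ × AncEq p t x
    marked′ a∈ with replace-∈ xs (u , v , false) a∈
    ... | inj₁ a∈′  = marked a∈′
    ... | inj₂ refl = u≤ , u-v

    settled′ : ∀ {t x} → (t , x , false) ∈ as′ → AncEq p x t → N x < index φ → Pending as′ p φ x
    settled′ a∈ q lt with replace-∈ xs (u , v , false) a∈
    ... | inj₁ a∈′ = pending lt (settled a∈′ q lt)
    ... | inj₂ ()

  -- First loop: contraction after the last arc into a vertex is marked.

  module LastMark {as p sm d i alive u v pv} (C : Core (st as p sm d (loop1 i)) alive)
    (U : Unfinished (_≡ v) as alive) (am : AllMarkedInto v as)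
    (Nu≡i : N u ≡ i) (u-v : PAnc p u v) (v∈ : v ∈ alive) (e-v : p v ≡ just pv) where

    open Core C

    N-v<i : N v < i
    N-v<i = subst (N v <_) Nu≡i (ancestor-num u-v)

    arc-pv : Edge as pv v
    arc-pv = parent-arc v∈ e-v

    pv∈ : pv ∈ alive
    pv∈ = proj₁ (ends-alive arc-pv)

    -- Every arc into v comes from v itself or from the tree path between u and v.
    v⇒pv : ∀ {a} → i ≤ N a → Avoiding (Edge as) s a v → Avoiding (Edge as) s a pv
    v⇒pv i≤a (source _) = ⊥-elim (descendant-≢s u-v refl)
    v⇒pv i≤a (extend {t} r (b , a∈) _) with refl ← am t b a∈ with marked a∈
    ... | t≤i , inj₁ refl = v⇒pv i≤a r
    ... | t≤i , inj₂ q with ancestor-via-parent p e-v q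
    ...   | inj₁ refl = r
    ...   | inj₂ q′   = descend (≤-trans t≤i i≤a) pv∈ q′ r

    ≢v : ∀ {a} → i ≤ N a → v ≢ a
    ≢v i≤a = N-<-≢ (<-≤-trans N-v<i i≤a)

    pv⇒v : ∀ {a} → i ≤ N a → Avoiding (Edge as) s a pv → Avoiding (Edge as) s a v
    pv⇒v i≤a r = extend r arc-pv (≢v i≤a)

    -- By `v⇒pv`, a walk to `v` avoiding `u` would give one to `u` itself, so `u` dominates `v` and,
    -- by `dom⇐`, also `w`. Any other strict dominator of `w` dominates `v` by `dom⇒`, hence `u`,
    -- because walks to `u` extend along the tree arc; `u ∈ sm u` carries this back to the input
    -- graph.
    idom : pv ≡ u → ∀ {w} → w ∈ sm v → IsIdom G u w
    idom refl {w} w∈ = proj₁ sd , ¬avoiding⇒dominates G (proj₂ sd) , closest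
      where
      i≤u : i ≤ N u
      i≤u = ≤-reflexive (sym Nu≡i)

      sd : StrictDom (FlowArc G) s u w
      sd = dom⇐ v∈ (descendant-≢s u-v) w∈ i≤u
             (≢v i≤u ∘ sym , λ r → avoiding-≢ (v⇒pv i≤u r) refl)

      closest : ∀ z → Dominates G z w → z ≢ w → Dominates G z u
      closest z z-dom z≢w with z ≟ u
      ... | yes refl = visits-last
      ... | no  z≢u
        with i≤z , _ , ¬r ← dom⇒ v∈ (descendant-≢s u-v) w∈ (z≢w , dominates⇒¬avoiding G z-dom)
        with u ≟ s
      -- If `u` is the start vertex, the tree arc from it to `v` alone is a walk that misses `z`.
      ...   | yes refl = ⊥-elim (¬r (pv⇒v i≤z (source (z≢u ∘ sym))))
      ...   | no  u≢s  = ¬avoiding⇒dominates G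
        (proj₂ (dom⇐ pv∈ u≢s (self pv∈) i≤z (z≢u , ¬r ∘ pv⇒v i≤z)))

    contract : ∀ {sm′ d′} → Doms (Edge as) (remove v alive) sm′ i → Covered (remove v alive) sm′ d′ →
      Inv (st (contractArcs v pv as) (contractPar v pv p) sm′ d′ (loop1 i)) (remove v alive)
    contract doms′ covered′ = record
      { shape = K.shape
      ; doms = doms-⇔ (λ i≤a x∈ → K.avoiding⁺ (≢v i≤a) (v⇒pv i≤a) (proj₂ (remove-⁻ alive x∈)))
                      (λ i≤a _ → K.avoiding⁻ (≢v i≤a) (v⇒pv i≤a)) doms′
      ; marked = marked′
      ; settled = settled′
      ; covered = covered′ ; in-range = in-range
      } , unfinished-contract {v = v} {pv} {as} (λ x∈ x≢s x≢v → U x∈ x≢s x≢v)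
      where
      to : ∀ {t x} → Edge as t x → Edge (contractArcs v pv as) (rename v pv t) (rename v pv x)
      to (b , a∈) = b , contract-∈⁺ v pv a∈

      from : ∀ {t′ x′} → Edge (contractArcs v pv as) t′ x′ →
        ∃₂ λ t x → Edge as t x × t′ ≡ rename v pv t × x′ ≡ rename v pv x
      from (b , a∈) with t , x , a∈′ , e , e′ ← contract-∈⁻ v pv a∈ = t , x , (b , a∈′) , e , e′

      module K = Contracting shape v∈ e-v to from

      marked′ : ∀ {t x} → (t , x , true) ∈ contractArcs v pv as → N t ≤ i × AncEq K.p′ t x
      marked′ a∈ with t , x , a∈′ , refl , refl ← contract-∈⁻ v pv a∈ with t≤i , q ← marked a∈′ =
        K.ren-num {t = t} u-v Nu≡i t≤i , K.ancEq⁺ q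

      settled′ : ∀ {t x} → (t , x , false) ∈ contractArcs v pv as → AncEq K.p′ x t → N x < i → ⊥
      settled′ a∈ q lt with t , x , a∈′ , refl , refl ← contract-∈⁻ v pv a∈ with x ≟ v
      ... | no  x≢v  = settled a∈′ (K.ancEq⁻ x≢v q) lt
      -- The arcs whose head becomes `pv` are the former arcs into `v`, and all of those are marked.
      ... | yes refl with () ← am _ _ a∈′

  -- Second loop: the transform step.

  module SecondLoop {as p sm d i alive u v pv ns} (I : Inv (st as p sm d (loop2 i)) alive)
    (Nu≡i : N u ≡ i) (vu∈ : (v , u , false) ∈ as) (u-v : PAnc p u v) (e-v : p v ≡ just pv)
    (z : Step0 p u v as ns) where

    open Core (proj₁ I)

    as⁺ : List (Arc n)
    as⁺ = as ++ ns

    u∈ : u ∈ alive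
    u∈ = proj₂ (ends-alive (_ , vu∈))

    v∈ : v ∈ alive
    v∈ = proj₁ (ends-alive (_ , vu∈))

    N-v<i : N v < i
    N-v<i = subst (N v <_) Nu≡i (ancestor-num u-v)

    u≢v : u ≢ v
    u≢v refl = N-<-≢ (ancestor-num u-v) refl

    old : ∀ {t x} → Edge as t x → Edge as⁺ t x
    old (b , a∈) = b , ∈-++⁺ˡ a∈

    added : ∀ {t x} → Edge as⁺ t x → Edge as t x ⊎ (p u ≡ just t × Edge as v x × PAnc p u x)
    added (b , a∈) with ∈-++⁻ as a∈
    ... | inj₁ a∈′ = inj₁ (b , a∈′)
    ... | inj₂ a∈′ = inj₂ (proj₂ (step0-∈ z a∈′))

    module A = Shortcuts shape u∈ old added
    open Shape A.shape using () renaming (descend to descend⁺)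

    pv∈ : pv ∈ alive
    pv∈ = proj₁ (ends-alive (parent-arc v∈ e-v))

    u≤ : ∀ {a} → suc i ≤ N a → N u < N a
    u≤ i<a = ≤-trans (s≤s (≤-reflexive Nu≡i)) i<a

    ≢v : ∀ {a} → suc i ≤ N a → v ≢ a
    ≢v i<a = N-<-≢ (<-trans N-v<i i<a)

    v⇒u : ∀ {a} → suc i ≤ N a → Avoiding (Edge as⁺) s a v → Avoiding (Edge as⁺) s a u
    v⇒u i<a r = extend r (old (_ , vu∈)) (N-<-≢ (u≤ i<a))

    u⇒v : ∀ {a} → suc i ≤ N a → Avoiding (Edge as⁺) s a u → Avoiding (Edge as⁺) s a v
    u⇒v i<a r = descend⁺ (<⇒≤ (u≤ i<a)) v∈ u-v r

    -- The back arc leads from `v` to `u`, and the tree path leads down from there to `pv`.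
    v⇒pv : ∀ {a} → suc i ≤ N a → Avoiding (Edge as⁺) s a v → Avoiding (Edge as⁺) s a pv
    v⇒pv i<a r with ancestor-via-parent p e-v u-v
    ... | inj₁ refl = v⇒u i<a r
    ... | inj₂ q    = descend⁺ (<⇒≤ (u≤ i<a)) pv∈ q (v⇒u i<a r)

    v≢s : v ≢ s
    v≢s = descendant-≢s u-v

    -- Once s is processed no other vertex is alive.
    u≢s : u ≢ s
    u≢s refl with i<s , _ ← dom⇒ v∈ v≢s (self v∈) (v≢s ∘ sym , ¬avoiding-source) =
      <-irrefl refl (u≤ i<s)

    to : ∀ {t x} → Edge as⁺ t x → Edge (contractArcs v pv as⁺) (rename v pv t) (rename v pv x)
    to (b , a∈) = b , contract-∈⁺ v pv a∈

    from : ∀ {t′ x′} → Edge (contractArcs v pv as⁺) t′ x′ →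
      ∃₂ λ t x → Edge as⁺ t x × t′ ≡ rename v pv t × x′ ≡ rename v pv x
    from (b , a∈) with t , x , a∈′ , e , e′ ← contract-∈⁻ v pv a∈ = t , x , (b , a∈′) , e , e′

    module K = Contracting A.shape v∈ e-v to from

    as′ : List (Arc n)
    as′ = contractArcs v pv as⁺

    doms′ : Doms (Edge as′) (remove v alive) (Merged u v sm) (suc i)
    -- From the inside out: add the shortcuts, merge `v` into `u`, drop `v`, contract.
    doms′ = doms-⇔ (λ i<a x∈ → K.avoiding⁺ (≢v i<a) (v⇒pv i<a) (proj₂ (remove-⁻ alive x∈)))
                   (λ i<a _ → K.avoiding⁻ (≢v i<a) (v⇒pv i<a))
            (doms-remove
            (doms-merge v∈ v≢s (s≤s (≤-reflexive Nu≡i)) (<-trans N-v<i (n<1+n i)) v⇒u u⇒v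
            (doms-⇔ (λ _ _ → avoiding-⊆ old) (λ i<a _ → A.avoiding⁻ (u≤ i<a) v∈ u-v) doms)))

    marked⁺ : ∀ {t x} → (t , x , true) ∈ as⁺ → N t ≤ i × AncEq p t x
    marked⁺ a∈ with ∈-++⁻ as a∈
    ... | inj₁ a∈′ = marked a∈′
    ... | inj₂ a∈′ with () , _ ← step0-∈ z a∈′

    marked′ : ∀ {t x} → (t , x , true) ∈ as′ → N t ≤ i × AncEq K.p′ t x
    marked′ a∈ with t , x , a∈′ , refl , refl ← contract-∈⁻ v pv a∈ with t≤i , q ← marked⁺ a∈′ =
      K.ren-num {t = t} u-v Nu≡i t≤i , K.ancEq⁺ q

    settled⁺ : ∀ {t x} → (t , x , false) ∈ as⁺ → AncEq p x t → N x < i → Pending as p (loop2 i) x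
    settled⁺ a∈ q lt with ∈-++⁻ as a∈
    ... | inj₁ a∈′ = settled a∈′ q lt
    -- A shortcut runs from the parent of `u` to a proper descendant of `u`, so numbers forbid its
    -- head to be the tail or an ancestor of it.
    ... | inj₂ a∈′ with _ , e , _ , u-x ← step0-∈ z a∈′ with q | <-trans (ancestor-num u-x) (num-mono e)
    ...   | inj₁ refl | x<t = ⊥-elim (<-irrefl refl x<t)
    ...   | inj₂ q′   | x<t = ⊥-elim (<-irrefl refl (<-trans x<t (ancestor-num q′)))

    to-u : ∀ {x y} → N y ≡ i → (x , y , false) ∈ as → (K.ren x , y , false) ∈ as′
    to-u {x} {y} Ny≡i a∈ = subst (λ y → (K.ren x , y , false) ∈ as′)
      (K.ren-≢ (λ { refl → <-irrefl Ny≡i N-v<i })) (contract-∈⁺ v pv (∈-++⁺ˡ a∈))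

    -- Arcs into `v` become arcs into `pv`, which may thereby regain back or loop arcs. The renamed
    -- arc from `pv` to `u` makes `pv` pending.
    pending-pv : N pv < i → Pending as′ K.p′ (loop2 i) pv
    pending-pv lt with ancestor-via-parent p e-v u-v
    ... | inj₁ refl = ⊥-elim (<-irrefl Nu≡i lt)
    ... | inj₂ u-pv = u , Nu≡i
      , subst (λ y → (y , u , false) ∈ as′) K.ren-v (to-u Nu≡i vu∈) , K.panc⁺ u≢v u-pv

    pending-old : ∀ {x} → x ≢ v → Pending as p (loop2 i) x → Pending as′ K.p′ (loop2 i) x
    pending-old x≢v (u′ , Nu′≡i , xu∈ , u-x) = u′ , Nu′≡i
      , subst (λ y → (y , u′ , false) ∈ as′) (K.ren-≢ x≢v) (to-u Nu′≡i xu∈)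
      , K.panc⁺ (λ { refl → <-irrefl Nu′≡i N-v<i }) u-x

    settled′ : ∀ {t x} → (t , x , false) ∈ as′ → AncEq K.p′ x t → N x < i → Pending as′ K.p′ (loop2 i) x
    settled′ a∈ q lt with t , x , a∈′ , refl , refl ← contract-∈⁻ v pv a∈ with x ≟ v
    ... | yes refl = pending-pv lt
    ... | no  x≢v  = pending-old x≢v (settled⁺ a∈′ (K.ancEq⁻ x≢v q) lt)

    inv : Inv (st as′ K.p′ (Merged u v sm) d (loop2 i)) (remove v alive)
    inv = record
      { shape = K.shape
      ; doms = doms′
      ; marked = marked′
      ; settled = settled′
      ; covered = covered-merge u∈ u≢v u≢s covered
      ; in-range = in-range
      } , unfinished-contract {v = v} {pv} {as⁺} λ x∈ x≢s _ am →
            proj₂ I x∈ x≢s (λ ()) λ t b a∈ → am t b (∈-++⁺ˡ a∈)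

  -- Ends of the two loops.

  -- Among the vertices dominated by u take one of greatest post-order number: by arc-direction
  -- its unmarked incoming arc is a back or loop arc, or leaves u, or leaves a vertex not
  -- dominated by u.
  dominates-none : ∀ {as p sm d i alive u bound} → (∀ x → post x < bound) →
    Inv (st as p sm d (loop1 i)) alive → N u ≡ i →
    (∀ v → (u , v , false) ∈ as → ¬ (TreeArc p u v ⊎ ForwardArc p u v)) →
    ∀ {x} → x ∈ alive → x ≢ u → ¬ ¬ Avoiding (Edge as) s u x
  dominates-none {as} {p} {i = i} {alive} {u} {bound} post< (C , U) Nu≡i exhausted x∈ x≢u =
    go (<-wellFounded _) x∈ x≢u
    where
    open Core C

    go : ∀ {x} → Acc _<_ (bound ∸ post x) → x ∈ alive → x ≢ u → ¬ ¬ Avoiding (Edge as) s u x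
    go {x} (acc rec) x∈ x≢u ¬r = U x∈ (descendant-≢s u-x) (λ ()) all-marked
      where
      u-x : PAnc p u x
      u-x = dominator-ancestor x∈ x≢u ¬r

      all-marked : AllMarkedInto x as
      all-marked t true  a∈ = refl
      all-marked t false a∈ with arc-direction (_ , a∈)
      ... | inj₁ q = ⊥-elim (settled a∈ q (subst (N x <_) Nu≡i (ancestor-num u-x)))
      ... | inj₂ lt with t ≟ u
      ...   | yes refl = ⊥-elim (exhausted x a∈ (tree-or-forward u-x))
      ...   | no  t≢u  = ⊥-elim (go (rec (∸-monoʳ-< lt (<⇒≤ (post< t))))
                           (proj₁ (ends-alive (_ , a∈))) t≢u (λ r → ¬r (extend r (_ , a∈) x≢u)))

  -- Raising the threshold to `suc i` drops only `u` from the dominators considered, and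
  -- `dominates-none` shows that `u` strictly dominates no alive vertex.
  exit1-core : ∀ {as p sm d i alive u bound} → (∀ x → post x < bound) → i < n → N u ≡ i →
    (∀ v → (u , v , false) ∈ as → ¬ (TreeArc p u v ⊎ ForwardArc p u v)) →
    Inv (st as p sm d (loop1 i)) alive → Core (st as p sm d (loop2 i)) alive
  exit1-core {as} {i = i} {alive} post< i<n Nu≡i exhausted I@(C , _) = record
    { shape = shape
    ; doms = record
      { self = self
      ; dom⇒ = λ x∈ x≢s w∈ sd → let i≤a , sd′ = dom⇒ x∈ x≢s w∈ sd in later-dominator x∈ i≤a sd′ , sd′
      ; dom⇐ = λ x∈ x≢s w∈ i<a → dom⇐ x∈ x≢s w∈ (<⇒≤ i<a)
      }
    ; marked = marked
    ; settled = λ a∈ q lt → ⊥-elim (settled a∈ q lt)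
    ; covered = covered ; in-range = i<n
    }
    where
    open Core C
    later-dominator : ∀ {a x} → x ∈ alive → i ≤ N a → StrictDom (Edge as) s a x → i < N a
    later-dominator x∈ i≤a (a≢x , ¬r) with m≤n⇒m<n∨m≡n i≤a
    ... | inj₁ i<a = i<a
    ... | inj₂ i≡a with refl ← N-injective (trans Nu≡i i≡a) =
      ⊥-elim (dominates-none post< I Nu≡i exhausted x∈ (a≢x ∘ sym) ¬r)

  -- A pending vertex has an unmarked back arc into `u`, which the exit condition forbids. The same
  -- condition settles `u` itself.
  exit2-core : ∀ {as p sm d i alive u} → N u ≡ i →
    (∀ v → (v , u , false) ∈ as → ¬ (BackArc p v u ⊎ LoopArc v u)) →
    Core (st as p sm d (loop2 i)) alive → Core (st as p sm d (loop1 (suc i))) alive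
  exit2-core {as} {p} {i = i} {u = u} Nu≡i exhausted C = record
    { shape = shape ; doms = doms
    ; marked = λ a∈ → let t≤i , q = marked a∈ in ≤-trans t≤i (n≤1+n i) , q
    ; settled = settled′
    ; covered = covered ; in-range = in-range
    }
    where
    open Core C
    settled′ : ∀ {t x} → (t , x , false) ∈ as → AncEq p x t → N x < suc i → ⊥
    settled′ {t} a∈ q (s≤s x≤i) with m≤n⇒m<n∨m≡n x≤i
    ... | inj₂ x≡i with refl ← N-injective (trans Nu≡i (sym x≡i)) = exhausted t a∈ (back-or-loop q)
      where
      back-or-loop : AncEq p u t → BackArc p t u ⊎ LoopArc t u
      back-or-loop (inj₁ e)  = inj₂ (sym e)
      back-or-loop (inj₂ q′) = inj₁ q′
    ... | inj₁ x<i with u′ , Nu′≡i , xu∈ , u-x ← settled a∈ q x<i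
      with refl ← N-injective (trans Nu≡i (sym Nu′≡i)) = exhausted _ xu∈ (inj₁ u-x)

  mark-loop : ∀ xs {ys u p sm d i alive} → N u ≡ i →
    Inv (st (xs ++ (u , u , false) ∷ ys) p sm d (loop2 i)) alive →
    Inv (st (xs ++ (u , u , true) ∷ ys) p sm d (loop2 i)) alive
  mark-loop xs {ys} {u} {p} {i = i} {alive} Nu≡i (C , U) = C′ , unfinished
    where
    as = xs ++ (u , u , false) ∷ ys
    as′ = xs ++ (u , u , true) ∷ ys

    pending : ∀ {x} → N x < i → Pending as p (loop2 i) x → Pending as′ p (loop2 i) x
    pending x<i (u′ , Nu′≡i , xu∈ , u-x) with replace-∈ xs (u , u , true) xu∈
    ... | inj₁ xu∈′ = u′ , Nu′≡i , xu∈′ , u-x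
    ... | inj₂ refl = ⊥-elim (<-irrefl Nu≡i x<i)

    C′ = mark-core xs C (≤-reflexive Nu≡i) (inj₁ refl) pending
    open Core C′

    -- The tree arc into u leaves a vertex that is not processed yet, so it is unmarked.
    unfinished : Unfinished (λ _ → ⊥) as′ alive
    unfinished {x} x∈ x≢s _ am with x ≟ u
    ... | no  x≢u  = unfinished-mark xs U x∈ x≢s x≢u am
    ... | yes refl with y , e , b , a∈ ← tree-arc x∈ x≢s with refl ← am y b a∈ =
      <-irrefl Nu≡i (<-≤-trans (num-mono e) (proj₁ (marked a∈)))

  -- Termination and preservation of the invariant.

  -- Twice `n ∸ i` in the first loop and, for `i < n`, one less in the second, split so that each
  -- exit lowers exactly one summand.
  rank : Phase → ℕ
  rank (loop1 i) = (n ∸ i) + (n ∸ i)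
  rank (loop2 i) = (n ∸ i) + (n ∸ suc i)

  Measure : Set
  Measure = ℕ × ℕ × ℕ

  measure : GDState n → List (Fin n) → Measure
  measure σ alive = rank (phase σ) , length alive , unmarkedCount (garcs σ)

  -- The order of the components matters: a transform step may add unmarked arcs, but it removes an
  -- alive vertex.
  _≺_ : Measure → Measure → Set
  _≺_ = ×-Lex _≡_ _<_ (×-Lex _≡_ _<_ _<_)

  ≺-wellFounded : WellFounded _≺_
  ≺-wellFounded = ×-wellFounded <-wellFounded (×-wellFounded <-wellFounded <-wellFounded)

  preserve : ∀ {bound σ τ alive} → (∀ x → post x < bound) → Inv σ alive → GDStep num σ τ →
    ∃ λ alive′ → Inv τ alive′ × measure τ alive′ ≺ measure σ alive
  preserve {alive = alive} _ (C , U) (mark1 {i} {i<n} {xs} {v = v} tf ¬am) =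
    alive , (mark-core xs C (≤-reflexive (N-vertexAt i i<n)) (inj₂ (tree-or-forward⁻ tf)) (λ _ ()) , unfinished)
          , inj₂ (refl , inj₂ (refl , unmarkedCount-mark xs))
    where
    unfinished : Unfinished (λ _ → ⊥) _ alive
    unfinished {x} x∈ x≢s _ am with x ≟ v
    ... | yes refl = ¬am am
    ... | no  x≢v  = unfinished-mark xs U x∈ x≢s x≢v am
  preserve _ (C , U) (mark1-idom {i} {i<n} {xs} tf am e-v) =
    _ , L.contract (doms-remove (Core.doms C′)) (covered-assign (L.idom refl) (Core.covered C))
      , inj₂ (refl , inj₁ (length-remove v∈))
    where
    u-v = tree-or-forward⁻ tf
    C′ = mark-core xs C (≤-reflexive (N-vertexAt i i<n)) (inj₂ u-v) (λ _ ())
    v∈ = proj₂ (Core.ends-alive C (_ , middle-∈ xs))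
    module L = LastMark C′ (unfinished-mark xs U) am (N-vertexAt i i<n) u-v v∈ e-v
  preserve _ (C , U) (mark1-same {i} {i<n} {xs} {v = v} {pv} tf am e-v pv≢u) =
    _ , L.contract
          (doms-remove (doms-merge v∈ (descendant-≢s u-v) N-pv<i L.N-v<i L.v⇒pv L.pv⇒v doms))
          (covered-merge L.pv∈ (λ { refl → <-irrefl refl (num-mono e-v) }) (descendant-≢s u-pv) covered)
      , inj₂ (refl , inj₁ (length-remove v∈))
    where
    u-v = tree-or-forward⁻ tf
    C′ = mark-core xs C (≤-reflexive (N-vertexAt i i<n)) (inj₂ u-v) (λ _ ())
    open Core C′
    v∈ = proj₂ (ends-alive (_ , middle-∈ xs))
    module L = LastMark C′ (unfinished-mark xs U) am (N-vertexAt i i<n) u-v v∈ e-v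

    -- As `pv` is not `u`, it lies properly below `u`: it is processed and is not the start vertex,
    -- as the merge requires.
    u-pv : PAnc _ (vertexAt num i i<n) pv
    u-pv with ancestor-via-parent _ e-v u-v
    ... | inj₁ u≡pv = ⊥-elim (pv≢u (sym u≡pv))
    ... | inj₂ q    = q

    N-pv<i : N pv < i
    N-pv<i = subst (N pv <_) (N-vertexAt i i<n) (ancestor-num u-pv)
  preserve post< I@(_ , U) (exit1 {i} {i<n} exhausted) =
    _ , (exit1-core post< i<n (N-vertexAt i i<n) exhausted I , U)
      , inj₁ (+-monoʳ-< (n ∸ i) (∸-monoʳ-< (n<1+n i) i<n))
  preserve _ I (mark2 {i} {i<n} {xs}) =
    _ , mark-loop xs (N-vertexAt i i<n) I , inj₂ (refl , inj₂ (refl , unmarkedCount-mark xs))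
  preserve _ I (transform {i} {i<n} vu∈ u-v e-v z) =
    _ , T.inv , inj₂ (refl , inj₁ (length-remove T.v∈))
    where module T = SecondLoop I (N-vertexAt i i<n) vu∈ u-v e-v z
  preserve _ (C , U) (exit2 {i} {i<n} exhausted) =
    _ , (exit2-core (N-vertexAt i i<n) exhausted C , U)
      , inj₁ (+-monoˡ-< (n ∸ suc i) (∸-monoʳ-< (n<1+n i) i<n))

  terminates : ∀ {bound σ alive} → (∀ x → post x < bound) → Inv σ alive →
    Acc _≺_ (measure σ alive) → Terminates num σ
  terminates post< I (acc rec) = acc λ τ-step →
    let _ , I′ , lt = preserve post< I τ-step in terminates post< I′ (rec lt)

  -- Progress, final states and the initial state.

  -- Nothing is decided about arcs or marks. In a stuck state the absence of contracting steps
  -- supplies the premise of `mark1`, and the absence of `mark1` supplies that of `exit1`.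
  loop1-steps : ∀ {as p sm d i} → i < n → ¬ (∀ τ → ¬ GDStep num (st as p sm d (loop1 i)) τ)
  loop1-steps {as} {p} {i = i} i<n stuck = stuck _ (exit1 {i<n = i<n} exhausted)
    where
    u = vertexAt num i i<n

    exhausted : ∀ v → (u , v , false) ∈ as → ¬ (TreeArc p u v ⊎ ForwardArc p u v)
    exhausted v a∈ tf with xs , ys , refl ← ∈-∃++ a∈ = stuck _ (mark1 {i<n = i<n} tf not-last)
      where
      not-last : ¬ AllMarkedInto v (xs ++ (u , v , true) ∷ ys)
      not-last am with pv , e-v ← has-parent (tree-or-forward⁻ tf) with pv ≟ u
      ... | yes refl = stuck _ (mark1-idom {i<n = i<n} tf am e-v)
      ... | no  pv≢u = stuck _ (mark1-same {i<n = i<n} tf am e-v pv≢u)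

  loop2-steps : ∀ {as p sm d i} → i < n → ¬ (∀ τ → ¬ GDStep num (st as p sm d (loop2 i)) τ)
  loop2-steps {as} {p} {i = i} i<n stuck = stuck _ (exit2 {i<n = i<n} exhausted)
    where
    u = vertexAt num i i<n

    exhausted : ∀ v → (v , u , false) ∈ as → ¬ (BackArc p v u ⊎ LoopArc v u)
    exhausted v a∈ (inj₂ refl) with xs , ys , refl ← ∈-∃++ a∈ = stuck _ (mark2 {i<n = i<n})
    exhausted v a∈ (inj₁ q) with pv , e-v ← has-parent q =
      step0-exists p u v as λ { (ns , z) → stuck _ (transform {i<n = i<n} a∈ q e-v z) }

  stuck-at-end : ∀ {σ alive} → Inv σ alive → (∀ τ → ¬ GDStep num σ τ) → phase σ ≡ loop1 n
  stuck-at-end {st _ _ _ _ (loop1 i)} (C , _) stuck with m≤n⇒m<n∨m≡n (Core.in-range C)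
  ... | inj₁ i<n  = ⊥-elim (loop1-steps i<n stuck)
  ... | inj₂ refl = refl
  stuck-at-end {st _ _ _ _ (loop2 i)} (C , _) stuck = ⊥-elim (loop2-steps (Core.in-range C) stuck)

  -- A vertex `w` still represented would be strictly dominated by the start vertex, so `dom⇒` would
  -- give that vertex a number of at least `n`.
  all-assigned : ∀ {as p sm d alive} → Core (st as p sm d (loop1 n)) alive →
    ∀ w → w ≢ s → ∃ λ x → d w ≡ just x × IsIdom G x w
  all-assigned C w w≢s with Core.covered C w w≢s
  ... | inj₂ done = done
  ... | inj₁ (x , x∈ , x≢s , w∈)
    with n≤s , _ ← Core.dom⇒ C x∈ x≢s w∈ (w≢s ∘ sym , ¬avoiding-source) =
    ⊥-elim (<-irrefl refl (<-≤-trans (N<n s) n≤s))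

  reachable-inv : ∀ {bound σ τ alive} → (∀ x → post x < bound) → Inv σ alive →
    Star (GDStep num) σ τ → ∃ (Inv τ)
  reachable-inv post< I ε = _ , I
  reachable-inv post< I (τ-step ◅ r) with _ , I′ , _ ← preserve post< I τ-step = reachable-inv post< I′ r

  unmarked : List (Fin n × Fin n) → List (Arc n)
  unmarked = map (λ { (x , y) → (x , y , false) })

  unmarked-∈⁺ : ∀ {t x as} → (t , x) ∈ as → (t , x , false) ∈ unmarked as
  unmarked-∈⁺ (here refl) = here refl
  unmarked-∈⁺ (there a∈)  = there (unmarked-∈⁺ a∈)

  unmarked-∈⁻ : ∀ {t x b as} → (t , x , b) ∈ unmarked as → (t , x) ∈ as × b ≡ false
  unmarked-∈⁻ {as = _ ∷ _} (here refl) = here refl , refl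
  unmarked-∈⁻ {as = _ ∷ _} (there a∈) with a∈′ , e ← unmarked-∈⁻ a∈ = there a∈′ , e

initial-inv : ∀ {n} (G : FlowGraph n) (p : Parent n) (num : Permutation′ n)
  (O : DepthFirst.PostOrder G p) → IsNumbering p num →
  Correctness.Inv G num (DepthFirst.PostOrder.post O) (initGD G p) (allFin n)
initial-inv {n} G p num O numbering = record
  { shape = record
    { ends-alive = λ _ → ∈-allFin _ , ∈-allFin _
    ; tree-arc = λ _ x≢s → let y , e , a = tree-arc x≢s in y , e , false , unmarked-∈⁺ a
    ; start-rootless = start-rootless
    ; num-mono = numbering _ _
    ; post-mono = post-mono
    ; nested = nested
    ; arc-direction = λ (b , a∈) → arc-direction (proj₁ (unmarked-∈⁻ a∈))
    }
  ; doms = record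
    { self = λ _ → here refl
    ; dom⇒ = λ { _ _ (here refl) (a≢x , ¬r) → z≤n , a≢x , ¬r ∘ avoiding-⊆ (λ (b , a∈) → proj₁ (unmarked-∈⁻ a∈)) }
    ; dom⇐ = λ { _ _ (here refl) _ (a≢x , ¬r) → a≢x , ¬r ∘ avoiding-⊆ (λ a∈ → false , unmarked-∈⁺ a∈) }
    }
  ; marked = λ a∈ → case proj₂ (unmarked-∈⁻ a∈) of λ ()
  ; settled = λ _ _ ()
  ; covered = λ w w≢s → inj₁ (w , ∈-allFin w , w≢s , here refl)
  ; in-range = z≤n
  } , unfinished
  where
  open DepthFirst.PostOrder O
  open Correctness G num post
  unfinished : Unfinished (λ _ → ⊥) (unmarked (arcs G)) (allFin n)
  unfinished x∈ x≢s _ am with y , _ , a ← tree-arc x≢s with () ← am y false (unmarked-∈⁺ a)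

theorem5 : ∀ {n} (G : FlowGraph n) (p : Parent n) (num : Permutation′ n) →
    IsDFSTree G p → IsNumbering p num →
    Terminates num (initGD G p) ×
    (∀ σ → Star (GDStep num) (initGD G p) σ → (∀ τ → ¬ GDStep num σ τ) →
    phase σ ≡ loop1 n ×
    (∀ w → w ≢ start G → ∃ λ x → dom σ w ≡ just x × IsIdom G x w))
theorem5 G p num run numbering =
  terminates post<bound I (≺-wellFounded _) , correct
  where
  O = DepthFirst.postOrder G run
  open DepthFirst.PostOrder O using (post; post<bound)
  open Correctness G num post
  I = initial-inv G p num O numbering

  correct : ∀ σ → Star (GDStep num) (initGD G p) σ → (∀ τ → ¬ GDStep num σ τ) →
    phase σ ≡ loop1 _ × (∀ w → w ≢ start G → ∃ λ x → dom σ w ≡ just x × IsIdom G x w)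
  correct σ reach stuck with alive , I′ ← reachable-inv post<bound I reach
    with σ | stuck-at-end I′ stuck | I′
  ... | st _ _ _ _ _ | refl | C , _ = refl , all-assigned C
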